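{- Let $\{P_\ell\}_{\ell=1}^{n!}$ be an enumeration of the set $\mathcal P_n$ of $n\times n$ permutation matrices and, for $A\in\mathcal D_n$, let $\alpha_\ell(A)$, $\ell=1,\dots,n!$, be the coefficients of the continuous Birkhoff decomposition of $A$ induced by this enumeration. Then each $\alpha_\ell:\mathcal D_n\to\mathbb R$ is an almost everywhere differentiable function.
   Context: $\mathcal D_n\subset\mathbb R^{n\times n}$ denotes the Birkhoff polytope, i.e. the set of $n\times n$ doubly stochastic matrices (non-negative entries, every row and every column sums to $1$). It lies in the $(n-1)^2$-dimensional affine subspace of $\mathbb R^{n^2}$ consisting of matrices all of whose row and column sums equal $1$. "Almost everywhere" and "differentiable" refer to the $(n-1)^2$-dimensional Lebesgue measure on, and differentiability within, this affine subspace. Continuous Birkhoff decomposition: given an enumeration $\{P_\ell\}_{\ell=1}^{n!}$ of $\mathcal P_n$ (a fixed total order on all permutation matrices) and $A\in\mathcal D_n$, the coefficients are defined recursively for $\ell=1,\dots,n!$ by $$\alpha_\ell=\min_{i,j}\Big\{A(i,j)-\sum_{m=1}^{\ell-1}\alpha_mP_m(i,j)\ \Big|\ P_\ell(i,j)=1\Big\}.$$ -}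

module Defs where

open import Algebra.Apartness.Bundles using (HeytingField)
open import Algebra.Bundles using (CommutativeRing)
import Algebra.Definitions.RawMonoid as RawMonoidDefs
open import Axiom.ExcludedMiddle using (ExcludedMiddle)
open import Data.Bool.Base using (if_then_else_)
open import Data.Fin.Base using (Fin; zero; suc; toℕ; inject; _<_)
open import Data.Fin.Induction using (<-wellFounded)
import Data.Fin.Permutation as Perm
open import Data.Fin.Permutation using (Permutation′; _⟨$⟩ʳ_)
open import Data.Fin.Properties using (_≟_)
open import Data.Maybe.Base using (Maybe; just; nothing)
open import Data.Nat.Base as ℕ using (ℕ; zero; suc; z≤n; s≤s; _!)
open import Data.Product.Base using (∃-syntax; _×_; _,_)
open import Data.Sum.Base using (_⊎_; inj₁; inj₂)
open import Data.Vec.Functional using (Vector; foldr; head; tail)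
open import Function.Definitions using (Bijective)
open import Induction.WellFounded using (Acc; acc)
import Level as L
open import Relation.Binary.Core using (Rel)
open import Relation.Binary.Lattice.Structures using (IsLattice)
open import Relation.Binary.PropositionalEquality.Core using (_≡_)
open import Relation.Binary.Structures using (IsStrictPartialOrder)
open import Relation.Nullary using (¬_; does; yes; no; contradiction)

-- The real numbers, axiomatised as a Cauchy-complete Archimedean ordered
-- field.  Classically these axioms determine ℝ up to isomorphism.  They
-- avoid decidability of the order, so that they also hold for Cauchy reals
-- in a constructive metatheory; hence x ≤ y is ¬ (y < x), apartness is
-- x < y or y < x, and binary minima and maxima are operations.

record Reals c ℓ₁ ℓ₂ : Set (L.suc (c L.⊔ ℓ₁ L.⊔ ℓ₂)) where
  infix  4 _<ᴿ_ _≤ᴿ_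
  infixl 6 _⊓_ _⊔_
  field
    heytingField : HeytingField c ℓ₁ ℓ₂

  open HeytingField heytingField public

  commutativeRing : CommutativeRing c ℓ₁
  commutativeRing = record { isCommutativeRing = isCommutativeRing }

  open CommutativeRing commutativeRing public
    using (+-rawMonoid; *-rawMonoid)

  field
    _<ᴿ_                 : Rel Carrier ℓ₂
    isStrictPartialOrder : IsStrictPartialOrder _≈_ _<ᴿ_
    <⇒#                  : ∀ {x y} → x <ᴿ y → x # y
    #⇒<⊎>                : ∀ {x y} → x # y → (x <ᴿ y) ⊎ (y <ᴿ x)
    +-monoˡ-<            : ∀ {x y} z → x <ᴿ y → x + z <ᴿ y + z
    *-pos                : ∀ {x y} → 0# <ᴿ x → 0# <ᴿ y → 0# <ᴿ x * y

  _≤ᴿ_ : Rel Carrier ℓ₂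
  x ≤ᴿ y = ¬ (y <ᴿ x)

  field
    _⊔_ _⊓_   : Carrier → Carrier → Carrier
    isLattice : IsLattice _≈_ _≤ᴿ_ _⊔_ _⊓_

  ∣_∣ : Carrier → Carrier
  ∣ x ∣ = x ⊔ (- x)

  open RawMonoidDefs +-rawMonoid public using (sum) renaming (_×_ to _·_)
  open RawMonoidDefs *-rawMonoid public using () renaming (sum to product)

  IsCauchy : (ℕ → Carrier) → Set (c L.⊔ ℓ₂)
  IsCauchy x = ∀ ε → 0# <ᴿ ε →
    ∃[ N ] (∀ i j → N ℕ.≤ i → N ℕ.≤ j → ∣ x i - x j ∣ <ᴿ ε)

  ConvergesTo : (ℕ → Carrier) → Carrier → Set (c L.⊔ ℓ₂)
  ConvergesTo x l = ∀ ε → 0# <ᴿ ε →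
    ∃[ N ] (∀ i → N ℕ.≤ i → ∣ x i - l ∣ <ᴿ ε)

  field
    archimedean : ∀ x → ∃[ k ] (x <ᴿ k · 1#)
    complete    : ∀ x → IsCauchy x → ∃[ l ] ConvergesTo x l

module Birkhoff {c ℓ₁ ℓ₂} (R : Reals c ℓ₁ ℓ₂) where

  open Reals R

  ℝ : Set c
  ℝ = Carrier

  Matrix : ℕ → Set c
  Matrix n = Vector (Vector ℝ n) n

  infixl 6 _⊕_ _⊖_
  _⊕_ _⊖_ : ∀ {n} → Matrix n → Matrix n → Matrix n
  (X ⊕ Y) i j = X i j + Y i j
  (X ⊖ Y) i j = X i j - Y i j

  infixl 7 _⊛_
  _⊛_ : ∀ {n} → ℝ → Matrix n → Matrix n
  (t ⊛ X) i j = t * X i j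

  infix 4 _≋_
  _≋_ : ∀ {n} → Rel (Matrix n) ℓ₁
  X ≋ Y = ∀ i j → X i j ≈ Y i j

  ∥_∥ : ∀ {n} → Matrix n → ℝ
  ∥ X ∥ = foldr _⊔_ 0# (λ i → foldr _⊔_ 0# (λ j → ∣ X i j ∣))

  record UnitLineSums {n} (A : Matrix n) : Set ℓ₁ where
    field
      rowSum : ∀ i → sum (λ j → A i j) ≈ 1#
      colSum : ∀ j → sum (λ i → A i j) ≈ 1#

  NonNegative : ∀ {n} → Matrix n → Set ℓ₂
  NonNegative A = ∀ i j → 0# ≤ᴿ A i j

  record DoublyStochastic n : Set (c L.⊔ ℓ₁ L.⊔ ℓ₂) where
    field
      matrix       : Matrix n
      nonNegative  : NonNegative matrix
      unitLineSums : UnitLineSums matrix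

  open DoublyStochastic public

  permutationMatrix : ∀ {n} → Permutation′ n → Matrix n
  permutationMatrix π i j = if does (π ⟨$⟩ʳ i ≟ j) then 1# else 0#

  minimum : ∀ {k} → Vector ℝ (suc k) → ℝ
  minimum v = foldr _⊓_ (head v) (tail v)

  -- Permutation matrices are represented by permutations: P (i , j) = 1
  -- exactly when j = π i.
  record Enumeration n : Set where
    field
      perm      : Fin (n !) → Permutation′ n
      bijective : Bijective _≡_ Perm._≈_ perm

  inject-< : ∀ {n} {i : Fin n} (j : Fin (toℕ i)) → inject j < i
  inject-< {i = suc _} zero    = s≤s z≤n
  inject-< {i = suc _} (suc j) = s≤s (inject-< j)

  -- Matrices have size suc m, so that the minimum is over a nonempty set.
  -- The positions (i , j) with P ℓ (i , j) = 1 are the pairs (i , π ℓ i), and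
  -- the inner sum is over all m < ℓ.  The accessibility argument only serves
  -- to justify the recursion.
  module _ {m} (P : Enumeration (suc m)) where
    open Enumeration P

    coefficientAcc : Matrix (suc m) → (ℓ : Fin (suc m !)) → Acc _<_ ℓ → ℝ
    coefficientAcc A ℓ (acc rs) = minimum λ i →
      let j = perm ℓ ⟨$⟩ʳ i in
      A i j - sum {toℕ ℓ} λ k →
        coefficientAcc A (inject k) (rs (inject-< k))
          * permutationMatrix (perm (inject k)) i j

    coefficient : Fin (suc m !) → DoublyStochastic (suc m) → ℝ
    coefficient ℓ A = coefficientAcc (matrix A) ℓ (<-wellFounded ℓ)

  record IsLinear {n} (T : Matrix n → ℝ) : Set (c L.⊔ ℓ₁) where
    field
      cong   : ∀ {X Y} → X ≋ Y → T X ≈ T Y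
      ⊕-homo : ∀ X Y → T (X ⊕ Y) ≈ T X + T Y
      ⊛-homo : ∀ t X → T (t ⊛ X) ≈ t * T X

  -- Fréchet differentiability within the affine subspace of unit line sums:
  -- A is interior to the Birkhoff polytope relative to that subspace, and f
  -- has a linear approximation there.  Only the values of the derivative on
  -- matrices with zero line sums matter; every linear functional on these
  -- extends to all matrices.
  record DifferentiableAt {n} (f : DoublyStochastic n → ℝ)
                          (A : DoublyStochastic n)
                          : Set (c L.⊔ ℓ₁ L.⊔ ℓ₂) where
    field
      interior : ∃[ r ] 0# <ᴿ r ×
        (∀ B → UnitLineSums B → ∥ B ⊖ matrix A ∥ <ᴿ r → NonNegative B)
      derivative : Matrix n → ℝ
      isLinear   : IsLinear derivative
      approximates : ∀ ε → 0# <ᴿ ε → ∃[ δ ] 0# <ᴿ δ ×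
        (∀ B → ∥ matrix B ⊖ matrix A ∥ <ᴿ δ →
          ∣ f B - f A - derivative (matrix B ⊖ matrix A) ∣
            ≤ᴿ ε * ∥ matrix B ⊖ matrix A ∥)

  -- Deleting the first row and column is an affine isomorphism from the
  -- (suc m × suc m)-matrices with unit line sums onto ℝ^(m × m).  Lebesgue
  -- measure on the affine subspace is, up to a constant factor, the one
  -- transported along this chart, so both have the same null sets.
  chart : ∀ {m} → Matrix (suc m) → Matrix m
  chart A i j = A (suc i) (suc j)

  record Box m : Set (c L.⊔ ℓ₂) where
    field
      lower upper : Matrix m
      lower≤upper : ∀ i j → lower i j ≤ᴿ upper i j

  open Box

  infix 4 _∈ᴮ_
  _∈ᴮ_ : ∀ {m} → Matrix m → Box m → Set ℓ₂
  X ∈ᴮ b = ∀ i j → (lower b i j ≤ᴿ X i j) × (X i j ≤ᴿ upper b i j)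

  volume : ∀ {m} → Box m → ℝ
  volume b = product λ i → product λ j → upper b i j - lower b i j

  -- A countable, possibly finite or empty, family of boxes.
  Boxes : ℕ → Set (c L.⊔ ℓ₂)
  Boxes m = ℕ → Maybe (Box m)

  volumeAt : ∀ {m} → Maybe (Box m) → ℝ
  volumeAt nothing  = 0#
  volumeAt (just b) = volume b

  TotalVolume≤ : ∀ {m} → Boxes m → ℝ → Set ℓ₂
  TotalVolume≤ U ε = ∀ N → sum {N} (λ k → volumeAt (U (toℕ k))) ≤ᴿ ε

  Covered : ∀ {m} → Boxes m → DoublyStochastic (suc m) → Set (c L.⊔ ℓ₂)
  Covered U A = ∃[ k ] ∃[ b ] (U k ≡ just b) × (chart (matrix A) ∈ᴮ b)

  Null : ∀ {m p} → (DoublyStochastic (suc m) → Set p) →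
         Set (c L.⊔ ℓ₁ L.⊔ ℓ₂ L.⊔ p)
  Null {m} S = ∀ ε → 0# <ᴿ ε →
    ∃[ U ] TotalVolume≤ {m} U ε × (∀ A → S A → Covered U A)

  -- The constructively positive form of "the set of points where P fails is
  -- null": off arbitrarily small covers, P holds.  Classically it is the same
  -- statement, as the two facts below show.
  AlmostEverywhere : ∀ {m p} → (DoublyStochastic (suc m) → Set p) →
                     Set (c L.⊔ ℓ₁ L.⊔ ℓ₂ L.⊔ p)
  AlmostEverywhere {m} P = ∀ ε → 0# <ᴿ ε →
    ∃[ U ] TotalVolume≤ {m} U ε × (∀ A → P A ⊎ Covered U A)

  ae⇒null : ∀ {m p} {P : DoublyStochastic (suc m) → Set p} →
            AlmostEverywhere P → Null (λ A → ¬ P A)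
  ae⇒null {P = P} ae ε 0<ε with ae ε 0<ε
  ... | U , small , cover = U , small , covered
    where
    covered : ∀ A → ¬ P A → Covered U A
    covered A ¬PA with cover A
    ... | inj₁ PA = contradiction PA ¬PA
    ... | inj₂ A∈U = A∈U

  null⇒ae : ∀ {m p} {P : DoublyStochastic (suc m) → Set p} →
            ExcludedMiddle p → Null (λ A → ¬ P A) → AlmostEverywhere P
  null⇒ae {P = P} em null ε 0<ε with null ε 0<ε
  ... | U , small , covered = U , small , cover
    where
    cover : ∀ A → P A ⊎ Covered U A
    cover A with em {P A}
    ... | yes PA = inj₁ PA
    ... | no ¬PA = inj₂ (covered A ¬PA)

{-# OPTIONS --safe #-}
module Submission where

open import Defs
open import Algebra.Bundles using (CommutativeRing)
import Algebra.Apartness.Properties.HeytingCommutativeRing as HeytingProperties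
import Algebra.Properties.CommutativeMonoid.Sum as CommutativeMonoidSum
import Algebra.Properties.Ring as RingProperties
import Algebra.Properties.Semiring.Mult as SemiringMult
import Algebra.Properties.Semiring.Sum as SemiringSum
import Algebra.Solver.Ring as RingSolver
open import Algebra.Solver.Ring.AlmostCommutativeRing
  using (fromCommutativeRing; _-Raw-AlmostCommutative⟶_)
open import Data.Bool.Base using (true; false; if_then_else_)
open import Data.Fin.Base using (Fin; zero; suc; toℕ; punchIn; inject; _<_)
open import Data.Fin.Induction using (<-wellFounded)
open import Data.Fin.Permutation using (_⟨$⟩ʳ_)
open import Data.Fin.Properties using (_≟_; punchInᵢ≢i)
open import Data.Integer.Base as ℤ using (ℤ; +_; -[1+_])
import Data.Integer.Properties as ℤ
open import Data.List.Base using (List; []; _∷_; [_]; _++_; cartesianProductWith)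
open import Data.List.Membership.Propositional using (_∈_)
open import Data.List.Membership.Propositional.Properties
  using (∈-cartesianProductWith⁺; ∈-++⁺ˡ; ∈-++⁺ʳ)
open import Data.List.Relation.Unary.All as All using (All; []; _∷_)
open import Data.List.Relation.Unary.Any using (Any; here; there)
open import Data.List.Relation.Unary.Any.Properties using (++⁺ˡ; ++⁺ʳ)
open import Data.Maybe.Base using (Maybe; just; nothing)
open import Data.Nat.Base as ℕ using (ℕ; zero; suc; _!)
import Data.Nat.Properties as ℕ
open import Data.Product.Base using (∃-syntax; _×_; _,_; proj₁; proj₂)
open import Data.Product.Properties using (≡-dec)
open import Data.Sum.Base as Sum using (_⊎_; inj₁; inj₂)
open import Data.Vec.Functional using (Vector; removeAt; foldr)
open import Function.Base using (_∘_)
open import Induction.WellFounded using (Acc; acc)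
import Level as L
open import Relation.Binary.Definitions using (DecidableEquality)
open import Relation.Binary.Lattice.Structures using (IsLattice)
open import Relation.Binary.PropositionalEquality.Core as ≡ using (_≡_; _≢_)
import Relation.Binary.Reasoning.Setoid as SetoidReasoning
open import Relation.Binary.Structures using (IsStrictPartialOrder)
open import Relation.Nullary using (¬_; yes; no; does; contradiction)

-- Each coefficient is built from the entries of A by subtraction and minima,
-- so near any point it is one of finitely many linear functionals with integer
-- coefficients, provided that of any two competing functionals in a minimum
-- the difference is either identically zero on matrices with unit line sums or
-- apart from zero at A.  In the chart such a difference is an affine function
-- with integer coefficients, hence is constant or has an entry X p whose
-- coefficient is apart from zero; in the latter case thin slabs around its
-- zero set are covered by boxes of small total volume.  Positivity of all
-- entries, which makes A an interior point, is generic for the same reason.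

-- Two constructive obstacles shape the argument. Whether a real number vanishes cannot be decided,
-- and two reals cannot be compared outright; for integers the first question is decidable, and
-- comparison up to a tolerance is always possible. Integer coefficients serve the first purpose,
-- slabs of positive thickness the second. Moreover the boxes must be listed before `A` is given,
-- while the functional active at `A` depends on `A`; hence each function carries a finite list of
-- candidates that is independent of `A`, and all pairwise differences are made generic at once. A
-- slab is covered without integration: all coordinates but `p` are cut so finely that their terms
-- are nearly constant on a piece, and the inequality is then solved for the coordinate `p`. A point
-- cannot be located in an exact subdivision, so neighbouring pieces overlap; the doubled volume is
-- paid for by halving `ε`.

module IntegerCoefficients {c ℓ} (CR : CommutativeRing c ℓ) where

  -- Integers as coefficients for the ring solver.

  open CommutativeRing CR
  open RingProperties ring
  open SemiringMult semiring using (×-homo-+; ×1-homo-*) renaming (_×_ to _·_)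
  open SetoidReasoning setoid

  ⟦_⟧ : ℤ → Carrier
  ⟦ + 0 ⟧          = 0#
  -- A separate case, so that `con (+ 1)` evaluates to `1#` and not to `1# + 0#`.
  ⟦ + 1 ⟧          = 1#
  ⟦ + (suc (suc n)) ⟧ = 1# + (suc n · 1#)
  ⟦ -[1+ n ] ⟧     = - (suc n · 1#)

  ⟦+_⟧ : ∀ n → ⟦ + n ⟧ ≈ n · 1#
  ⟦+ 0 ⟧           = refl
  ⟦+ 1 ⟧           = sym (+-identityʳ 1#)
  ⟦+ suc (suc n) ⟧ = refl

  ⟦⊖⟧ : ∀ m n → ⟦ m ℤ.⊖ n ⟧ ≈ m · 1# - n · 1#
  ⟦⊖⟧ zero    zero    = sym (-‿inverseʳ 0#)
  ⟦⊖⟧ zero    (suc n) = sym (+-identityˡ _)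
  ⟦⊖⟧ (suc m) zero    = begin
    ⟦ + suc m ⟧        ≈⟨ ⟦+ suc m ⟧ ⟩
    suc m · 1#         ≈⟨ +-identityʳ _ ⟨
    suc m · 1# + 0#    ≈⟨ +-congˡ -0#≈0# ⟨
    suc m · 1# - 0#    ∎
  ⟦⊖⟧ (suc m) (suc n) = begin
    ⟦ suc m ℤ.⊖ suc n ⟧           ≡⟨ ≡.cong ⟦_⟧ (ℤ.[1+m]⊖[1+n]≡m⊖n m n) ⟩
    ⟦ m ℤ.⊖ n ⟧                   ≈⟨ ⟦⊖⟧ m n ⟩
    m · 1# - n · 1#               ≈⟨ +-congʳ (+-identityˡ _) ⟨
    0# + m · 1# - n · 1#          ≈⟨ +-congʳ (+-congʳ (-‿inverseʳ 1#)) ⟨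
    (1# - 1#) + m · 1# - n · 1#   ≈⟨ +-congʳ (+-assoc _ _ _) ⟩
    1# + (- 1# + m · 1#) - n · 1# ≈⟨ +-congʳ (+-congˡ (+-comm _ _)) ⟩
    1# + (m · 1# - 1#) - n · 1#   ≈⟨ +-congʳ (+-assoc _ _ _) ⟨
    suc m · 1# - 1# - n · 1#      ≈⟨ +-assoc _ _ _ ⟩
    suc m · 1# + (- 1# - n · 1#)  ≈⟨ +-congˡ (-‿+-comm 1# _) ⟩
    suc m · 1# - suc n · 1#       ∎

  +-homo : ∀ x y → ⟦ x ℤ.+ y ⟧ ≈ ⟦ x ⟧ + ⟦ y ⟧
  +-homo (+ m)    (+ n)    = begin
    ⟦ + (m ℕ.+ n) ⟧     ≈⟨ ⟦+ m ℕ.+ n ⟧ ⟩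
    (m ℕ.+ n) · 1#      ≈⟨ ×-homo-+ 1# m n ⟩
    m · 1# + n · 1#     ≈⟨ +-cong ⟦+ m ⟧ ⟦+ n ⟧ ⟨
    ⟦ + m ⟧ + ⟦ + n ⟧   ∎
  +-homo (+ m)    -[1+ n ] = begin
    ⟦ m ℤ.⊖ suc n ⟧          ≈⟨ ⟦⊖⟧ m (suc n) ⟩
    m · 1# - suc n · 1#      ≈⟨ +-congʳ ⟦+ m ⟧ ⟨
    ⟦ + m ⟧ + ⟦ -[1+ n ] ⟧   ∎
  +-homo -[1+ m ] (+ n)    = begin
    ⟦ n ℤ.⊖ suc m ⟧          ≈⟨ ⟦⊖⟧ n (suc m) ⟩
    n · 1# - suc m · 1#      ≈⟨ +-congʳ ⟦+ n ⟧ ⟨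
    ⟦ + n ⟧ - suc m · 1#     ≈⟨ +-comm _ _ ⟩
    ⟦ -[1+ m ] ⟧ + ⟦ + n ⟧   ∎
  +-homo -[1+ m ] -[1+ n ] = begin
    - ((2 ℕ.+ (m ℕ.+ n)) · 1#)       ≡⟨ ≡.cong (λ k → - (suc k · 1#)) (ℕ.+-suc m n) ⟨
    - ((suc m ℕ.+ suc n) · 1#)       ≈⟨ -‿cong (×-homo-+ 1# (suc m) (suc n)) ⟩
    - (suc m · 1# + suc n · 1#)      ≈⟨ -‿+-comm _ _ ⟨
    ⟦ -[1+ m ] ⟧ + ⟦ -[1+ n ] ⟧      ∎

  -‿homo : ∀ x → ⟦ ℤ.- x ⟧ ≈ - ⟦ x ⟧
  -‿homo (+ zero)  = sym -0#≈0#
  -‿homo (+ suc n) = -‿cong (sym ⟦+ suc n ⟧)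
  -‿homo -[1+ n ]  = trans ⟦+ suc n ⟧ (sym (-‿involutive _))

  ⟦-_*⟧ : ∀ m y → ⟦ (+ m) ℤ.* y ⟧ ≈ ⟦ + m ⟧ * ⟦ y ⟧ → ⟦ (ℤ.- (+ m)) ℤ.* y ⟧ ≈ - ⟦ + m ⟧ * ⟦ y ⟧
  ⟦- m *⟧ y eq = begin
    ⟦ (ℤ.- (+ m)) ℤ.* y ⟧  ≡⟨ ≡.cong ⟦_⟧ (ℤ.neg-distribˡ-* (+ m) y) ⟨
    ⟦ ℤ.- ((+ m) ℤ.* y) ⟧  ≈⟨ -‿homo ((+ m) ℤ.* y) ⟩
    - ⟦ (+ m) ℤ.* y ⟧      ≈⟨ -‿cong eq ⟩
    - (⟦ + m ⟧ * ⟦ y ⟧)    ≈⟨ -‿distribˡ-* _ _ ⟩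
    - ⟦ + m ⟧ * ⟦ y ⟧      ∎

  ⟦+*+⟧ : ∀ m n → ⟦ (+ m) ℤ.* (+ n) ⟧ ≈ ⟦ + m ⟧ * ⟦ + n ⟧
  ⟦+*+⟧ m n = begin
    ⟦ (+ m) ℤ.* (+ n) ⟧    ≡⟨ ≡.cong ⟦_⟧ (ℤ.pos-* m n) ⟨
    ⟦ + (m ℕ.* n) ⟧        ≈⟨ ⟦+ m ℕ.* n ⟧ ⟩
    (m ℕ.* n) · 1#         ≈⟨ ×1-homo-* m n ⟩
    m · 1# * (n · 1#)      ≈⟨ *-cong ⟦+ m ⟧ ⟦+ n ⟧ ⟨
    ⟦ + m ⟧ * ⟦ + n ⟧      ∎

  ⟦+*⟧ : ∀ m y → ⟦ (+ m) ℤ.* y ⟧ ≈ ⟦ + m ⟧ * ⟦ y ⟧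
  ⟦+*⟧ m (+ n)    = ⟦+*+⟧ m n
  ⟦+*⟧ m -[1+ n ] = begin
    ⟦ (+ m) ℤ.* -[1+ n ] ⟧         ≡⟨ ≡.cong ⟦_⟧ (ℤ.*-comm (+ m) -[1+ n ]) ⟩
    ⟦ -[1+ n ] ℤ.* (+ m) ⟧         ≈⟨ ⟦- suc n *⟧ (+ m) (⟦+*+⟧ (suc n) m) ⟩
    - ⟦ + suc n ⟧ * ⟦ + m ⟧        ≈⟨ *-comm _ _ ⟩
    ⟦ + m ⟧ * - ⟦ + suc n ⟧        ≈⟨ *-congˡ (-‿cong ⟦+ suc n ⟧) ⟩
    ⟦ + m ⟧ * ⟦ -[1+ n ] ⟧         ∎

  *-homo : ∀ x y → ⟦ x ℤ.* y ⟧ ≈ ⟦ x ⟧ * ⟦ y ⟧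
  *-homo (+ m)    y = ⟦+*⟧ m y
  *-homo -[1+ m ] y = trans (⟦- suc m *⟧ y (⟦+*⟧ (suc m) y)) (*-congʳ (-‿cong ⟦+ suc m ⟧))

  morphism : ℤ.+-*-rawRing -Raw-AlmostCommutative⟶ fromCommutativeRing CR
  morphism = record
    { ⟦_⟧    = ⟦_⟧
    ; +-homo = +-homo
    ; *-homo = *-homo
    ; -‿homo = -‿homo
    ; 0-homo = refl
    ; 1-homo = refl
    }

  coefficient≟ : ∀ x y → Maybe (⟦ x ⟧ ≈ ⟦ y ⟧)
  coefficient≟ x y with x ℤ.≟ y
  ... | yes ≡.refl = just refl
  -- Distinct integers may have equal images in a general commutative ring.
  ... | no  _      = nothing

  open RingSolver ℤ.+-*-rawRing (fromCommutativeRing CR) morphism coefficient≟ public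
    using (solve; _:=_; _:+_; _:*_; _:-_; :-_; con)

-- Order arithmetic in the reals without trichotomy.

module OrderedField {c ℓ₁ ℓ₂} (R : Reals c ℓ₁ ℓ₂) where

  open Reals R public hiding (zero)
  open CommutativeRing commutativeRing public
    using (ring; semiring; *-commutativeMonoid)
  open RingProperties ring public
    using (-0#≈0#; -‿distribˡ-*; -‿distribʳ-*; -‿involutive; -‿+-comm)
  open HeytingProperties heytingCommutativeRing public
    using (1#0; #-congʳ; x-0≈x)
  open IsStrictPartialOrder isStrictPartialOrder public
    using (<-respˡ-≈; <-respʳ-≈) renaming (irrefl to <-irrefl; trans to <-trans; asym to <-asym)
  open IsLattice isLattice public
    using (x≤x∨y; y≤x∨y; ∨-least; x∧y≤x; x∧y≤y; ∧-greatest)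
    renaming (refl to ≤-refl; reflexive to ≤-reflexive; antisym to ≤-antisym; trans to ≤-trans)
  open IntegerCoefficients commutativeRing public

  private variable
    x y z u v : Carrier

  IsInteger : Carrier → Set ℓ₁
  IsInteger x = ∃[ k ] x ≈ ⟦ k ⟧

  -- Abstract, so that later goals do not unfold the proofs found by the solver.
  abstract

    -- Cotransitivity of apartness, read through `#⇒<⊎>`. It stands in for trichotomy: a number can
    -- be compared with two distinct points, though not with a single one.
    <-cotrans : x <ᴿ y → ∀ z → x <ᴿ z ⊎ z <ᴿ y
    <-cotrans x<y z with #-cotrans (<⇒# x<y) z
    ... | inj₁ x#z with #⇒<⊎> x#z
    ...   | inj₁ x<z = inj₁ x<z
    ...   | inj₂ z<x = inj₂ (<-trans z<x x<y)
    <-cotrans x<y z | inj₂ z#y with #⇒<⊎> z#y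
    ...   | inj₁ z<y = inj₂ z<y
    ...   | inj₂ y<z = inj₁ (<-trans x<y y<z)

    <⇒≤ : x <ᴿ y → x ≤ᴿ y
    <⇒≤ = <-asym

    <-≤-trans : x <ᴿ y → y ≤ᴿ z → x <ᴿ z
    <-≤-trans {z = z} x<y y≤z with <-cotrans x<y z
    ... | inj₁ x<z = x<z
    ... | inj₂ z<y = contradiction z<y y≤z

    ≤-<-trans : x ≤ᴿ y → y <ᴿ z → x <ᴿ z
    ≤-<-trans {x = x} x≤y y<z with <-cotrans y<z x
    ... | inj₁ y<x = contradiction y<x x≤y
    ... | inj₂ x<z = x<z

    ≤-respˡ-≈ : x ≈ y → x ≤ᴿ z → y ≤ᴿ z
    ≤-respˡ-≈ x≈y x≤z z<y = x≤z (<-respʳ-≈ (sym x≈y) z<y)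

    ≤-respʳ-≈ : y ≈ z → x ≤ᴿ y → x ≤ᴿ z
    ≤-respʳ-≈ y≈z x≤y z<x = x≤y (<-respˡ-≈ (sym y≈z) z<x)

    0<y-x⇒x<y : 0# <ᴿ y - x → x <ᴿ y
    0<y-x⇒x<y {y} {x} 0<y-x =
      <-respˡ-≈ (+-identityˡ x) (<-respʳ-≈ y-x+x≈y (+-monoˡ-< x 0<y-x))
      where
      y-x+x≈y : y - x + x ≈ y
      y-x+x≈y = solve 2 (λ y x → y :- x :+ x := y) refl y x

    x<y⇒0<y-x : x <ᴿ y → 0# <ᴿ y - x
    x<y⇒0<y-x {x} {y} x<y = <-respˡ-≈ (-‿inverseʳ x) (+-monoˡ-< (- x) x<y)

    0≤y-x⇒x≤y : 0# ≤ᴿ y - x → x ≤ᴿ y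
    0≤y-x⇒x≤y {y} {x} 0≤y-x y<x =
      0≤y-x (<-respʳ-≈ (-‿inverseʳ x) (+-monoˡ-< (- x) y<x))

    x≤y⇒0≤y-x : x ≤ᴿ y → 0# ≤ᴿ y - x
    x≤y⇒0≤y-x {x} {y} x≤y y-x<0 = x≤y
      (<-respˡ-≈ (solve 2 (λ y x → y :- x :+ x := y) refl y x)
        (<-respʳ-≈ (+-identityˡ x) (+-monoˡ-< x y-x<0)))

    -- Linear inequalities are proved by exhibiting the difference of the two
    -- sides as a sum of terms of known sign; the solver checks the identity.
    <-from : 0# <ᴿ z → z ≈ y - x → x <ᴿ y
    <-from 0<z z≈y-x = 0<y-x⇒x<y (<-respʳ-≈ z≈y-x 0<z)

    ≤-from : 0# ≤ᴿ z → z ≈ y - x → x ≤ᴿ y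
    ≤-from 0≤z z≈y-x = 0≤y-x⇒x≤y (≤-respʳ-≈ z≈y-x 0≤z)

    +-pos : 0# <ᴿ x → 0# <ᴿ y → 0# <ᴿ x + y
    +-pos {x} {y} 0<x 0<y = <-trans 0<y (<-respˡ-≈ (+-identityˡ y) (+-monoˡ-< y 0<x))

    +-nonNeg : 0# ≤ᴿ x → 0# ≤ᴿ y → 0# ≤ᴿ x + y
    +-nonNeg {x} {y} 0≤x 0≤y x+y<0 with <-cotrans x+y<0 y
    ... | inj₂ y<0   = 0≤y y<0
    ... | inj₁ x+y<y = 0≤x (<-from (x<y⇒0<y-x x+y<y)
      (solve 2 (λ x y → y :- (x :+ y) := con (+ 0) :- x) refl x y))

    +-pos-nonNeg : 0# <ᴿ x → 0# ≤ᴿ y → 0# <ᴿ x + y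
    +-pos-nonNeg {x} {y} 0<x 0≤y = <-≤-trans 0<x
      (≤-from 0≤y (solve 2 (λ x y → y := (x :+ y) :- x) refl x y))

    +-mono-≤ : x ≤ᴿ y → u ≤ᴿ v → x + u ≤ᴿ y + v
    +-mono-≤ {x} {y} {u} {v} x≤y u≤v = ≤-from (+-nonNeg (x≤y⇒0≤y-x x≤y) (x≤y⇒0≤y-x u≤v))
      (solve 4 (λ x y u v → (y :- x) :+ (v :- u) := (y :+ v) :- (x :+ u)) refl x y u v)

    x<0⇒0<-x : x <ᴿ 0# → 0# <ᴿ - x
    x<0⇒0<-x {x} x<0 = <-respʳ-≈ (+-identityˡ (- x)) (x<y⇒0<y-x x<0)

    0<-x⇒x<0 : 0# <ᴿ - x → x <ᴿ 0#
    0<-x⇒x<0 {x} 0<-x = 0<y-x⇒x<y (<-respʳ-≈ (sym (+-identityˡ (- x))) 0<-x)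

    0<⇒#0 : 0# <ᴿ x → x # 0#
    0<⇒#0 0<x = #-sym (<⇒# 0<x)

    0<1 : 0# <ᴿ 1#
    0<1 with #⇒<⊎> 1#0
    ... | inj₂ 0<1 = 0<1
    ... | inj₁ 1<0 = <-respʳ-≈
      (trans (sym (-‿distribˡ-* 1# (- 1#))) (trans (-‿cong (*-identityˡ _)) (-‿involutive 1#)))
      (*-pos 0<-1 0<-1)
      where
      0<-1 : 0# <ᴿ - 1#
      0<-1 = x<0⇒0<-x 1<0

    0≤1 : 0# ≤ᴿ 1#
    0≤1 = <⇒≤ 0<1

    inverse : x # 0# → ∃[ y ] x * y ≈ 1#
    inverse {x} x#0 with #⇒invertible x#0
    ... | y , _ , eq = y , trans (*-congʳ (sym (x-0≈x x))) eq

    inverse-# : x * y ≈ 1# → x # 0#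
    inverse-# {x} {y} xy≈1 = invertible⇒# (y ,
      trans (*-comm _ _) (trans (*-congʳ (x-0≈x x)) xy≈1) ,
      trans (*-congʳ (x-0≈x x)) xy≈1)

    -- Apartness from zero is invertibility, and a factor of an invertible element is invertible.
    *-#0ˡ : x * y # 0# → x # 0#
    *-#0ˡ {x} {y} xy#0 with inverse xy#0
    ... | z , xyz≈1 = inverse-# (trans (sym (*-assoc x y z)) xyz≈1)

    *-#0ʳ : x * y # 0# → y # 0#
    *-#0ʳ {x} {y} xy#0 = *-#0ˡ (#-congʳ (*-comm x y) xy#0)

    -- As `≤ᴿ` is a negation, the product may be assumed negative; both factors are then apart from
    -- zero, so their signs can be decided.
    *-nonNeg : 0# ≤ᴿ x → 0# ≤ᴿ y → 0# ≤ᴿ x * y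
    *-nonNeg 0≤x 0≤y xy<0 with #⇒<⊎> (*-#0ˡ (<⇒# xy<0)) | #⇒<⊎> (*-#0ʳ (<⇒# xy<0))
    ... | inj₁ x<0 | _        = 0≤x x<0
    ... | inj₂ _   | inj₁ y<0 = 0≤y y<0
    ... | inj₂ 0<x | inj₂ 0<y = <-asym xy<0 (*-pos 0<x 0<y)

    inverse-pos : 0# <ᴿ x → ∃[ y ] 0# <ᴿ y × x * y ≈ 1#
    inverse-pos {x} 0<x with inverse (0<⇒#0 0<x)
    ... | y , xy≈1 with #⇒<⊎> (inverse-# {y} {x} (trans (*-comm y x) xy≈1))
    ...   | inj₂ 0<y = y , 0<y , xy≈1
    ...   | inj₁ y<0 = contradiction 0<1 (<-asym (0<-x⇒x<0
      (<-respʳ-≈ (trans (sym (-‿distribʳ-* x y)) (-‿cong xy≈1))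
        (*-pos 0<x (x<0⇒0<-x y<0)))))

    halve : 0# <ᴿ x → ∃[ y ] 0# <ᴿ y × y + y ≈ x
    halve {x} 0<x with inverse-pos (+-pos 0<1 0<1)
    ... | h , 0<h , 2h≈1 = x * h , *-pos 0<x 0<h , (begin
      x * h + x * h         ≈⟨ distribˡ x h h ⟨
      x * (h + h)           ≈⟨ *-congˡ (+-cong (*-identityˡ h) (*-identityˡ h)) ⟨
      x * (1# * h + 1# * h) ≈⟨ *-congˡ (distribʳ h 1# 1#) ⟨
      x * ((1# + 1#) * h)   ≈⟨ *-congˡ 2h≈1 ⟩
      x * 1#                ≈⟨ *-identityʳ x ⟩
      x                     ∎)
      where open SetoidReasoning setoid

    x≤x+y : 0# ≤ᴿ y → x ≤ᴿ x + y
    x≤x+y {y} {x} 0≤y = ≤-from 0≤y (solve 2 (λ x y → y := (x :+ y) :- x) refl x y)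

    half< : 0# <ᴿ y → y + y ≈ x → y <ᴿ x
    half< {y} 0<y 2y≈x = <-respʳ-≈ 2y≈x (<-respˡ-≈ (+-identityˡ y) (+-monoˡ-< y 0<y))

    -- Since `x` and `y` cannot be compared, `y` is located relative to the pair consisting of half
    -- of `x` and `x`: either half of `x` or `y` itself lies below both.
    positive-lowerBound : 0# <ᴿ x → 0# <ᴿ y → ∃[ z ] 0# <ᴿ z × z ≤ᴿ x × z ≤ᴿ y
    positive-lowerBound {x} {y} 0<x 0<y = compare (halve 0<x)
      where
      compare : ∃[ h ] 0# <ᴿ h × h + h ≈ x → ∃[ z ] 0# <ᴿ z × z ≤ᴿ x × z ≤ᴿ y
      compare (h , 0<h , 2h≈x) = choose (<-cotrans h<x y)
        where
        h<x : h <ᴿ x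
        h<x = half< 0<h 2h≈x
        choose : h <ᴿ y ⊎ y <ᴿ x → ∃[ z ] 0# <ᴿ z × z ≤ᴿ x × z ≤ᴿ y
        choose (inj₁ h<y) = h , 0<h , <⇒≤ h<x , <⇒≤ h<y
        choose (inj₂ y<x) = y , 0<y , <⇒≤ y<x , ≤-refl

    x≤∣x∣ : ∀ x → x ≤ᴿ ∣ x ∣
    x≤∣x∣ x = x≤x∨y x (- x)

    -x≤∣x∣ : ∀ x → - x ≤ᴿ ∣ x ∣
    -x≤∣x∣ x = y≤x∨y x (- x)

    ∣x∣<r⇒ : ∣ x ∣ <ᴿ z → - z <ᴿ x × x <ᴿ z
    ∣x∣<r⇒ {x} {z} ∣x∣<z =
      <-from (x<y⇒0<y-x (≤-<-trans (-x≤∣x∣ x) ∣x∣<z))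
        (solve 2 (λ x z → z :- (:- x) := x :- (:- z)) refl x z) ,
      ≤-<-trans (x≤∣x∣ x) ∣x∣<z

    0≤∣x∣ : ∀ x → 0# ≤ᴿ ∣ x ∣
    0≤∣x∣ x ∣x∣<0 = <-asym (≤-<-trans (x≤∣x∣ x) ∣x∣<0)
      (<-respʳ-≈ (-‿involutive x) (x<0⇒0<-x (≤-<-trans (-x≤∣x∣ x) ∣x∣<0)))

    ∣0∣≤0 : x ≈ 0# → ∣ x ∣ ≤ᴿ 0#
    ∣0∣≤0 {x} x≈0 = ∨-least (≤-reflexive x≈0) (≤-reflexive (trans (-‿cong x≈0) -0#≈0#))

    ·1-nonNeg : ∀ n → 0# ≤ᴿ n · 1#
    ·1-nonNeg zero    = ≤-refl
    ·1-nonNeg (suc n) = +-nonNeg 0≤1 (·1-nonNeg n)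

    ·1-pos : ∀ n → 0# <ᴿ suc n · 1#
    ·1-pos n = +-pos-nonNeg 0<1 (·1-nonNeg n)

    ⊓-cong : x ≈ y → u ≈ v → x ⊓ u ≈ y ⊓ v
    ⊓-cong x≈y u≈v = ≤-antisym (⊓-mono x≈y u≈v) (⊓-mono (sym x≈y) (sym u≈v))
      where
      ⊓-mono : ∀ {x y u v} → x ≈ y → u ≈ v → x ⊓ u ≤ᴿ y ⊓ v
      ⊓-mono {x} {u = u} x≈y u≈v =
        ∧-greatest (≤-respʳ-≈ x≈y (x∧y≤x x u)) (≤-respʳ-≈ u≈v (x∧y≤y x u))

    x≤y⇒x⊓y≈x : x ≤ᴿ y → x ⊓ y ≈ x
    x≤y⇒x⊓y≈x {x} {y} x≤y = ≤-antisym (x∧y≤x x y) (∧-greatest ≤-refl x≤y)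

    y≤x⇒x⊓y≈y : y ≤ᴿ x → x ⊓ y ≈ y
    y≤x⇒x⊓y≈y {y} {x} y≤x = ≤-antisym (x∧y≤y x y) (∧-greatest y≤x ≤-refl)

    isInteger-0 : IsInteger 0#
    isInteger-0 = + 0 , refl

    isInteger-1 : IsInteger 1#
    isInteger-1 = + 1 , refl

    isInteger-+ : IsInteger x → IsInteger y → IsInteger (x + y)
    isInteger-+ (k , x≈k) (l , y≈l) = k ℤ.+ l , trans (+-cong x≈k y≈l) (sym (+-homo k l))

    isInteger-neg : IsInteger x → IsInteger (- x)
    isInteger-neg (k , x≈k) = ℤ.- k , trans (-‿cong x≈k) (sym (-‿homo k))

    -- The zero test that real numbers do not admit. It is the reason for carrying integrality along
    -- with every functional.
    integer-≈0⊎#0 : IsInteger x → x ≈ 0# ⊎ x # 0#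
    integer-≈0⊎#0 (+ zero , x≈k)   = inj₁ x≈k
    integer-≈0⊎#0 (+ suc n , x≈k)  = inj₂ (#-congʳ (sym (trans x≈k ⟦+ suc n ⟧)) (0<⇒#0 (·1-pos n)))
    integer-≈0⊎#0 (-[1+ n ] , x≈k) = inj₂ (#-congʳ (sym x≈k) (<⇒# (0<-x⇒x<0
      (<-respʳ-≈ (sym (-‿involutive _)) (·1-pos n)))))

-- Boxes, their volumes, and boxes with one side replaced.

module Covers {c ℓ₁ ℓ₂} (R : Reals c ℓ₁ ℓ₂) where

  open OrderedField R
  open Birkhoff R
  open Box
  open SemiringSum semiring using (sum-remove; sum-cong-≋)
  open SemiringMult semiring using (×-assoc-*) renaming (×-congʳ to ·-congʳ)
  private module Product = CommutativeMonoidSum *-commutativeMonoid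

  private variable
    m n : ℕ

  product-nonNeg : (v : Vector ℝ n) → (∀ i → 0# ≤ᴿ v i) → 0# ≤ᴿ product v
  product-nonNeg {zero}  v 0≤v = 0≤1
  product-nonNeg {suc n} v 0≤v = *-nonNeg (0≤v zero) (product-nonNeg (v ∘ suc) (0≤v ∘ suc))

  volume-nonNeg : (b : Box m) → 0# ≤ᴿ volume b
  volume-nonNeg b = product-nonNeg _ λ i → product-nonNeg _ λ j → x≤y⇒0≤y-x (lower≤upper b i j)

  product-scale : ∀ {t} (v w : Vector ℝ n) i → w i ≈ t * v i →
                  (∀ k → k ≢ i → w k ≈ v k) → product w ≈ t * product v
  product-scale {n = suc n} {t} v w i wᵢ≈tvᵢ w≈v = begin
    product w                            ≈⟨ Product.sum-remove w ⟩
    w i * product (removeAt w i)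
      ≈⟨ *-cong wᵢ≈tvᵢ (Product.sum-cong-≋ λ k → w≈v _ (punchInᵢ≢i i k)) ⟩
    t * v i * product (removeAt v i)     ≈⟨ *-assoc _ _ _ ⟩
    t * (v i * product (removeAt v i))   ≈⟨ *-congˡ (Product.sum-remove v) ⟨
    t * product v                        ∎
    where open SetoidReasoning setoid

  Position : ℕ → Set
  Position m = Fin m × Fin m

  _≟ᴾ_ : DecidableEquality (Position m)
  _≟ᴾ_ = ≡-dec _≟_ _≟_

  entry : Matrix m → Position m → ℝ
  entry X (i , j) = X i j

  set : Matrix m → Position m → ℝ → Matrix m
  set X p x i j = if does ((i , j) ≟ᴾ p) then x else X i j

  -- With suitable `Q`, the orderedness and nondegeneracy of a modified box, membership in it, and
  -- the integrality of matrix units are all instances.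
  set-elim : ∀ {q} (Q : ℝ → ℝ → Position m → Set q) {X Y : Matrix m} {x y} {p} →
             Q x y p → (∀ i j → Q (X i j) (Y i j) (i , j)) →
             ∀ i j → Q (set X p x i j) (set Y p y i j) (i , j)
  set-elim Q {p = p} new old i j with (i , j) ≟ᴾ p
  ... | yes ≡.refl = new
  ... | no  _      = old i j

  set-≡ : ∀ (X : Matrix m) p x → entry (set X p x) p ≡ x
  set-≡ X p x with p ≟ᴾ p
  ... | yes _  = ≡.refl
  ... | no p≢p = contradiction ≡.refl p≢p

  set-≢ : ∀ (X : Matrix m) {p q} x → q ≢ p → entry (set X p x) q ≡ entry X q
  set-≢ X {p} {q} x q≢p with q ≟ᴾ p
  ... | yes q≡p = contradiction q≡p q≢p
  ... | no  _   = ≡.refl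

  setSide : (b : Box m) → Position m → ∀ {l u} → l ≤ᴿ u → Box m
  setSide b p {l} {u} l≤u = record
    { lower       = set (lower b) p l
    ; upper       = set (upper b) p u
    ; lower≤upper = set-elim (λ x y _ → x ≤ᴿ y) l≤u (lower≤upper b)
    }

  width : Box m → Position m → ℝ
  width b p = entry (upper b) p - entry (lower b) p

  ∈-setSide : ∀ (b : Box m) p {X l u} (l≤u : l ≤ᴿ u) → X ∈ᴮ b →
              l ≤ᴿ entry X p → entry X p ≤ᴿ u → X ∈ᴮ setSide b p l≤u
  ∈-setSide b p {X} l≤u X∈b l≤x x≤u =
    set-elim (λ l u q → (l ≤ᴿ entry X q) × (entry X q ≤ᴿ u)) (l≤x , x≤u) X∈b

  width-setSide-≢ : ∀ (b : Box m) {p q l u} (l≤u : l ≤ᴿ u) → q ≢ p →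
                    width (setSide b p l≤u) q ≈ width b q
  width-setSide-≢ b l≤u q≢p =
    reflexive (≡.cong₂ _-_ (set-≢ (upper b) _ q≢p) (set-≢ (lower b) _ q≢p))

  volume-setSide : ∀ (b : Box m) p {l u t} (l≤u : l ≤ᴿ u) → u - l ≈ t * width b p →
                   volume (setSide b p l≤u) ≈ t * volume b
  volume-setSide b p@(i , j) {l} {u} {t} l≤u u-l≈tw =
    product-scale _ _ i
      (product-scale _ _ j
        (trans (reflexive (≡.cong₂ _-_ (set-≡ (upper b) p u) (set-≡ (lower b) p l))) u-l≈tw)
        (λ k k≢j → width-setSide-≢ b {q = i , k} l≤u (k≢j ∘ ≡.cong proj₂)))
      (λ k k≢i → Product.sum-cong-≋ λ k′ →
        width-setSide-≢ b {q = k , k′} l≤u (k≢i ∘ ≡.cong proj₁))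

  -- Finite covers and properties that hold off small finite covers.

  totalVolume : List (Box m) → ℝ
  totalVolume []       = 0#
  totalVolume (b ∷ bs) = volume b + totalVolume bs

  totalVolume-nonNeg : (bs : List (Box m)) → 0# ≤ᴿ totalVolume bs
  totalVolume-nonNeg []       = ≤-refl
  totalVolume-nonNeg (b ∷ bs) = +-nonNeg (volume-nonNeg b) (totalVolume-nonNeg bs)

  totalVolume-++ : (bs bs′ : List (Box m)) →
                   totalVolume (bs ++ bs′) ≈ totalVolume bs + totalVolume bs′
  totalVolume-++ []       bs′ = sym (+-identityˡ _)
  totalVolume-++ (b ∷ bs) bs′ = trans (+-congˡ (totalVolume-++ bs bs′)) (sym (+-assoc _ _ _))

  infix 4 _∈∪_
  _∈∪_ : Matrix m → List (Box m) → Set (c L.⊔ ℓ₂)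
  X ∈∪ bs = Any (X ∈ᴮ_) bs

  record Cover {s} (S : Matrix m → Set s) (v : ℝ) : Set (c L.⊔ ℓ₂ L.⊔ s) where
    field
      boxes  : List (Box m)
      small  : totalVolume boxes ≤ᴿ v
      covers : ∀ X → S X → X ∈∪ boxes

  open Cover

  cover-⋃ : ∀ {s} n (S : Fin n → Matrix m → Set s) {v} → (∀ k → Cover (S k) v) →
            Cover (λ X → ∃[ k ] S k X) (n · v)
  cover-⋃ zero    S C = record { boxes = [] ; small = ≤-refl ; covers = λ { _ (() , _) } }
  cover-⋃ (suc n) S C = record
    { boxes  = boxes (C zero) ++ boxes rest
    ; small  = ≤-respˡ-≈ (sym (totalVolume-++ (boxes (C zero)) (boxes rest)))
                 (+-mono-≤ (small (C zero)) (small rest))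
    ; covers = λ
      { X (zero  , X∈S) → ++⁺ˡ (covers (C zero) X X∈S)
      ; X (suc k , X∈S) → ++⁺ʳ (boxes (C zero)) (covers rest X (k , X∈S))
      }
    }
    where
    rest = cover-⋃ n (S ∘ suc) (C ∘ suc)

  toBoxes : List (Box m) → Boxes m
  toBoxes []       _       = nothing
  toBoxes (b ∷ bs) zero    = just b
  toBoxes (b ∷ bs) (suc k) = toBoxes bs k

  toBoxes-volume : (bs : List (Box m)) → TotalVolume≤ (toBoxes bs) (totalVolume bs)
  toBoxes-volume bs       zero    = totalVolume-nonNeg bs
  toBoxes-volume {m} []   (suc N) = ≤-respˡ-≈ (sym (+-identityˡ _)) (toBoxes-volume {m} [] N)
  toBoxes-volume (b ∷ bs) (suc N) = +-mono-≤ ≤-refl (toBoxes-volume bs N)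

  toBoxes-covered : ∀ bs (A : DoublyStochastic (suc m)) →
                    chart (matrix A) ∈∪ bs → Covered (toBoxes bs) A
  toBoxes-covered (b ∷ bs) A (here A∈b)   = 0 , b , ≡.refl , A∈b
  toBoxes-covered (b ∷ bs) A (there A∈bs) =
    let k , b′ , eq , A∈b′ = toBoxes-covered bs A A∈bs in suc k , b′ , eq , A∈b′

  -- Lists of boxes, unlike sequences, are simply concatenated, and every exceptional set met here
  -- is a finite union of slabs in a bounded region. The list is chosen before `A`.
  FinitelyAE : ∀ {p} → (DoublyStochastic (suc m) → Set p) → Set (c L.⊔ ℓ₁ L.⊔ ℓ₂ L.⊔ p)
  FinitelyAE {m} P = ∀ ε → 0# <ᴿ ε →
    ∃[ bs ] totalVolume {m} bs ≤ᴿ ε × (∀ A → P A ⊎ chart (matrix A) ∈∪ bs)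

  finitelyAE⇒ae : ∀ {p} {P : DoublyStochastic (suc m) → Set p} →
                  FinitelyAE P → AlmostEverywhere P
  finitelyAE⇒ae {P = P} ae ε 0<ε =
    let bs , bs≤ε , cover = ae ε 0<ε in
    toBoxes bs , (λ N → ≤-trans (toBoxes-volume bs N) bs≤ε) , covered bs cover
    where
    covered : ∀ bs → (∀ A → P A ⊎ chart (matrix A) ∈∪ bs) → ∀ A → P A ⊎ Covered (toBoxes bs) A
    covered bs cover A with cover A
    ... | inj₁ PA  = inj₁ PA
    ... | inj₂ A∈U = inj₂ (toBoxes-covered bs A A∈U)

  module _ {p q} {P : DoublyStochastic (suc m) → Set p} {Q : DoublyStochastic (suc m) → Set q} where

    ae-map : (∀ A → P A → Q A) → FinitelyAE P → FinitelyAE Q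
    ae-map f ae ε 0<ε =
      let bs , bs≤ε , cover = ae ε 0<ε in bs , bs≤ε , λ A → Sum.map₁ (f A) (cover A)

    ae-∩ : FinitelyAE P → FinitelyAE Q → FinitelyAE (λ A → P A × Q A)
    ae-∩ ae-P ae-Q ε 0<ε =
      let η , 0<η , 2η≈ε = halve 0<ε
          bs , bs≤η , P∪bs = ae-P η 0<η
          bs′ , bs′≤η , Q∪bs′ = ae-Q η 0<η
      in bs ++ bs′ ,
         ≤-respʳ-≈ 2η≈ε (≤-respˡ-≈ (sym (totalVolume-++ bs bs′)) (+-mono-≤ bs≤η bs′≤η)) ,
         λ A → combine bs bs′ A (P∪bs A) (Q∪bs′ A)
      where
      combine : ∀ bs bs′ A → P A ⊎ chart (matrix A) ∈∪ bs → Q A ⊎ chart (matrix A) ∈∪ bs′ →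
                P A × Q A ⊎ chart (matrix A) ∈∪ (bs ++ bs′)
      combine bs bs′ A (inj₁ PA)   (inj₁ QA)    = inj₁ (PA , QA)
      combine bs bs′ A (inj₂ A∈bs) _            = inj₂ (++⁺ˡ A∈bs)
      combine bs bs′ A (inj₁ _)    (inj₂ A∈bs′) = inj₂ (++⁺ʳ bs A∈bs′)

  ae-always : ∀ {p} {P : DoublyStochastic (suc m) → Set p} → (∀ A → P A) → FinitelyAE P
  ae-always P ε 0<ε = [] , <⇒≤ 0<ε , λ A → inj₁ (P A)

  ae-∀ : ∀ {p} n {P : Fin n → DoublyStochastic (suc m) → Set p} →
         (∀ k → FinitelyAE (P k)) → FinitelyAE (λ A → ∀ k → P k A)
  ae-∀ zero    ae = ae-always λ _ ()
  ae-∀ (suc n) ae = ae-map (λ { A (P₀ , P₊) zero → P₀ ; A (P₀ , P₊) (suc k) → P₊ k })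
    (ae-∩ (ae zero) (ae-∀ n (ae ∘ suc)))

  -- Thin slabs around the zero sets of affine functions.

  Nondegenerate : Box m → Set ℓ₂
  Nondegenerate b = ∀ i j → lower b i j <ᴿ upper b i j

  -- The width of the slab is uniform in c and b, so that the boxes may be
  -- subdivided along one coordinate after another; the side in direction p is
  -- kept at length 1 for the last step, which solves for the p-th entry.
  ThinSlabs : Position m → (Matrix m → ℝ) → Set (c L.⊔ ℓ₁ L.⊔ ℓ₂)
  ThinSlabs p φ = ∀ ε → 0# <ᴿ ε → ∃[ δ ] 0# <ᴿ δ × (∀ c b → Nondegenerate b → width b p ≈ 1# →
    Cover (λ X → X ∈ᴮ b × - δ <ᴿ φ X + c × φ X + c <ᴿ δ) (ε * volume b))

  -- Twice `M * δ - k * y` equals `(M - k) * (y + δ) + (M + k) * (δ - y)`, a sum of products of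
  -- nonnegative factors. This avoids a case distinction on the signs of `k` and `y`.
  *-bounded : ∀ {k M y δ} → k ≤ᴿ M → - k ≤ᴿ M → - δ ≤ᴿ y → y ≤ᴿ δ → k * y ≤ᴿ M * δ
  *-bounded {k} {M} {y} {δ} k≤M -k≤M -δ≤y y≤δ Mδ<ky = <-irrefl refl (<-≤-trans double<0 double≥0)
    where
    d : ℝ
    d = M * δ - k * y
    d<0 : d <ᴿ 0#
    d<0 = <-from (x<y⇒0<y-x Mδ<ky)
      (solve 2 (λ a b → b :- a := con (+ 0) :- (a :- b)) refl (M * δ) (k * y))
    double<0 : d + d <ᴿ 0#
    double<0 = <-trans (<-respʳ-≈ (+-identityˡ d) (+-monoˡ-< d d<0)) d<0
    double≥0 : 0# ≤ᴿ d + d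
    double≥0 = ≤-respʳ-≈
      (solve 4 (λ k M y δ → (M :- k) :* (y :- :- δ) :+ (M :- :- k) :* (δ :- y)
        := (M :* δ :- k :* y) :+ (M :* δ :- k :* y)) refl k M y δ)
      (+-nonNeg (*-nonNeg (x≤y⇒0≤y-x k≤M) (x≤y⇒0≤y-x -δ≤y))
                (*-nonNeg (x≤y⇒0≤y-x -k≤M) (x≤y⇒0≤y-x y≤δ)))

  -- Adding `1#` makes the bound positive, hence invertible, even if `k` is zero.
  ∣_∣-bound : ∀ k → ∃[ M ] 0# <ᴿ M × k ≤ᴿ M × - k ≤ᴿ M
  ∣ k ∣-bound = ∣ k ∣ + 1# , <-respʳ-≈ (+-comm 1# ∣ k ∣) (+-pos-nonNeg 0<1 (0≤∣x∣ k)) ,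
    ≤-trans (x≤∣x∣ k) (x≤x+y 0≤1) , ≤-trans (-x≤∣x∣ k) (x≤x+y 0≤1)

  -- With `k` inverse to `h`, the entry at `p` equals `k * y - k * c` for `y = h * entry X p + c`,
  -- so it lies within `M * δ = η` of `- (k * c)`. This interval has length `η + η = ε`; putting it
  -- in place of a side of length 1 multiplies the volume by exactly `ε`.
  thinSlabs-scaledEntry : ∀ (p : Position m) {h} → h # 0# → ThinSlabs p (λ X → h * entry X p)
  thinSlabs-scaledEntry p {h} h#0 ε 0<ε =
    let η , 0<η , 2η≈ε = halve 0<ε
        k , hk≈1 = inverse h#0
        M , 0<M , k≤M , -k≤M = ∣ k ∣-bound
        μ , 0<μ , Mμ≈1 = inverse-pos 0<M
        M[ημ]≈η = trans (*-congˡ (*-comm η μ)) (trans (sym (*-assoc M μ η))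
          (trans (*-congʳ Mμ≈1) (*-identityˡ η)))
    in η * μ , *-pos 0<η 0<μ , λ c b _ width≈1 →
      solved η 0<η 2η≈ε k hk≈1 M k≤M -k≤M (η * μ) M[ημ]≈η c b width≈1
    where
    solved : ∀ η → 0# <ᴿ η → η + η ≈ ε → ∀ k → h * k ≈ 1# → ∀ M → k ≤ᴿ M → - k ≤ᴿ M →
             ∀ δ → M * δ ≈ η → ∀ c b → width b p ≈ 1# →
             Cover (λ X → X ∈ᴮ b × - δ <ᴿ h * entry X p + c × h * entry X p + c <ᴿ δ) (ε * volume b)
    solved η 0<η 2η≈ε k hk≈1 M k≤M -k≤M δ Mδ≈η c b width≈1 = record
      { boxes  = [ b′ ]
      ; small  = ≤-reflexive (trans (+-identityʳ _) (volume-setSide b p l≤u u-l≈ε*width))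
      ; covers = λ X (X∈b , -δ<y , y<δ) → here (∈-setSide b p {X} l≤u X∈b
          (above (entry X p) (<⇒≤ -δ<y) (<⇒≤ y<δ)) (below (entry X p) (<⇒≤ -δ<y) (<⇒≤ y<δ)))
      }
      where
      hkx≈x : ∀ x → h * k * x ≈ x
      hkx≈x x = trans (*-congʳ hk≈1) (*-identityˡ x)
      above : ∀ x → - δ ≤ᴿ h * x + c → h * x + c ≤ᴿ δ → - (k * c) - η ≤ᴿ x
      above x -δ≤y y≤δ = ≤-from
        (x≤y⇒0≤y-x (*-bounded -k≤M (≤-respˡ-≈ (sym (-‿involutive k)) k≤M) -δ≤y y≤δ))
        (trans (+-congʳ Mδ≈η) (trans
          (solve 5 (λ h k x c η →
            η :- (:- k) :* (h :* x :+ c) := h :* k :* x :- (:- (k :* c) :- η)) refl h k x c η)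
          (+-congʳ (hkx≈x x))))
      below : ∀ x → - δ ≤ᴿ h * x + c → h * x + c ≤ᴿ δ → x ≤ᴿ - (k * c) + η
      below x -δ≤y y≤δ = ≤-from
        (x≤y⇒0≤y-x (*-bounded k≤M -k≤M -δ≤y y≤δ))
        (trans (+-congʳ Mδ≈η) (trans
          (solve 5 (λ h k x c η →
            η :- k :* (h :* x :+ c) := (:- (k :* c) :+ η) :- h :* k :* x) refl h k x c η)
          (+-congˡ (-‿cong (hkx≈x x)))))
      u-l≈ε : (- (k * c) + η) - (- (k * c) - η) ≈ ε
      u-l≈ε = trans (solve 2 (λ a η → (a :+ η) :- (a :- η) := η :+ η) refl (- (k * c)) η) 2η≈ε
      l≤u : - (k * c) - η ≤ᴿ - (k * c) + η
      l≤u = ≤-from (<⇒≤ 0<ε) (sym u-l≈ε)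
      u-l≈ε*width : (- (k * c) + η) - (- (k * c) - η) ≈ ε * width b p
      u-l≈ε*width = trans u-l≈ε (trans (sym (*-identityʳ ε)) (*-congˡ (sym width≈1)))
      b′ = setSide b p l≤u

  -- The pieces have step `s` but length `s + s`. In the overlap of neighbours lies the gap between
  -- `l + s` and `l + s + s`, where cotransitivity decides whether to stop or to move on. The last
  -- piece overshoots the interval by `s`, which is harmless for a cover.
  subinterval : ∀ K {l x s} → 0# <ᴿ s → l ≤ᴿ x → x ≤ᴿ l + suc K · s →
                ∃[ k ] l + toℕ {suc K} k · s ≤ᴿ x × x ≤ᴿ l + toℕ k · s + (s + s)
  subinterval zero {l} {x} {s} 0<s l≤x x≤u =
    zero , ≤-respˡ-≈ (sym (+-identityʳ l)) l≤x ,
    ≤-trans x≤u (≤-from (<⇒≤ 0<s)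
      (solve 2 (λ l s → s := (l :+ con (+ 0) :+ (s :+ s)) :- (l :+ (s :+ con (+ 0)))) refl l s))
  subinterval (suc K) {l} {x} {s} 0<s l≤x x≤u = choose (<-cotrans l+s<l+2s x)
    where
    l+s<l+2s : l + s <ᴿ l + 0# + (s + s)
    l+s<l+2s = <-from 0<s (solve 2 (λ l s → s := (l :+ con (+ 0) :+ (s :+ s)) :- (l :+ s)) refl l s)
    choose : l + s <ᴿ x ⊎ x <ᴿ l + 0# + (s + s) →
             ∃[ k ] l + toℕ {suc (suc K)} k · s ≤ᴿ x × x ≤ᴿ l + toℕ k · s + (s + s)
    choose (inj₂ x<l+2s) = zero , ≤-respˡ-≈ (sym (+-identityʳ l)) l≤x , <⇒≤ x<l+2s
    choose (inj₁ l+s<x)  =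
      let k , lk≤x , x≤uk = subinterval K 0<s (<⇒≤ l+s<x) (≤-respʳ-≈ (sym (+-assoc l s _)) x≤u) in
      suc k , ≤-respˡ-≈ (+-assoc l s _) lk≤x , ≤-respʳ-≈ (+-congʳ (+-assoc l s _)) x≤uk

  fine-subdivision : ∀ {v δ} → 0# <ᴿ v → 0# <ᴿ δ →
                     ∃[ K ] ∃[ ν ] 0# <ᴿ ν × suc K · 1# * ν ≈ 1# × v * ν ≤ᴿ δ
  fine-subdivision {v} {δ} 0<v 0<δ =
    let d , 0<d , δd≈1 = inverse-pos 0<δ
        K , vd<K = archimedean (v * d)
        ν , 0<ν , Nν≈1 = inverse-pos (·1-pos K)
        -- δ − vν = (1 + K − vd) δν, since δd = 1 and (1 + K) ν = 1.
        1+K-vd>0 = +-pos 0<1 (x<y⇒0<y-x vd<K)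
        eq = trans (solve 5 (λ N v d δ ν → (con (+ 1) :+ (N :- v :* d)) :* (δ :* ν)
              := δ :* ((con (+ 1) :+ N) :* ν) :- v :* ((δ :* d) :* ν)) refl (K · 1#) v d δ ν)
             (+-cong (trans (*-congˡ Nν≈1) (*-identityʳ δ))
               (-‿cong (*-congˡ (trans (*-congʳ δd≈1) (*-identityˡ ν)))))
    in K , ν , 0<ν , Nν≈1 , <⇒≤ (<-from (*-pos 1+K-vd>0 (*-pos 0<δ 0<ν)) eq)

  ·-*1 : ∀ n x → n · x ≈ n · 1# * x
  ·-*1 n x = sym (trans (×-assoc-* n 1# x) (·-congʳ n (*-identityˡ x)))

  -- On a short piece of the side `q` the new term is constant up to `δ`, so the slab of half-width
  -- `δ` lies in a slab of half-width `δ + δ = δ′` for `φ` alone, with a constant that depends on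
  -- the piece. This is where uniformity in `c` and `b` is used: `δ` is fixed first, and only the
  -- number of pieces depends on the box. Each of the `suc K` pieces has volume
  -- `(ν + ν) * volume b`, where `ν` is the inverse of their number, so the total is
  -- `(η + η) * volume b = ε * volume b`. As `q` differs from `p`, the side `p` keeps length 1.
  thinSlabs-+ : ∀ {p : Position m} {φ} q → q ≢ p → ∀ β → ThinSlabs p φ →
                ThinSlabs p (λ X → φ X + β * entry X q)
  thinSlabs-+ {m} {p} {φ} q q≢p β slabs ε 0<ε =
    let η , 0<η , 2η≈ε = halve 0<ε
        δ′ , 0<δ′ , slabs′ = slabs η 0<η
        δ , 0<δ , 2δ≈δ′ = halve 0<δ′
        M , 0<M , β≤M , -β≤M = ∣ β ∣-bound
    in δ , 0<δ , λ c b b-nondeg width≈1 →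
      let w = width b q
          0<w = x<y⇒0<y-x (b-nondeg (proj₁ q) (proj₂ q))
          -- The width enters twice because the overlapping pieces have length `w * ν + w * ν`; over
          -- such a length the term with coefficient `β` varies by at most `δ`.
          K , ν , 0<ν , Nν≈1 , Mwν≤δ = fine-subdivision (*-pos 0<M (+-pos 0<w 0<w)) 0<δ
      in split η 2η≈ε δ′ slabs′ δ 2δ≈δ′ M β≤M -β≤M c b b-nondeg width≈1 0<w K ν 0<ν Nν≈1 Mwν≤δ
    where
    split : ∀ η → η + η ≈ ε → ∀ δ′ →
            (∀ c b → Nondegenerate b → width b p ≈ 1# →
              Cover (λ X → X ∈ᴮ b × - δ′ <ᴿ φ X + c × φ X + c <ᴿ δ′) (η * volume b)) →
            ∀ δ → δ + δ ≈ δ′ → ∀ M → β ≤ᴿ M → - β ≤ᴿ M →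
            ∀ c b → Nondegenerate b → width b p ≈ 1# → 0# <ᴿ width b q →
            ∀ K ν → 0# <ᴿ ν → suc K · 1# * ν ≈ 1# →
            M * (width b q + width b q) * ν ≤ᴿ δ →
            Cover (λ X → X ∈ᴮ b × - δ <ᴿ φ X + β * entry X q + c × φ X + β * entry X q + c <ᴿ δ)
              (ε * volume b)
    split η 2η≈ε δ′ slabs′ δ 2δ≈δ′ M β≤M -β≤M c b b-nondeg width≈1 0<w K ν 0<ν Nν≈1 Mwν≤δ = record
      { boxes  = Cover.boxes union
      ; small  = ≤-respʳ-≈ total (Cover.small union)
      ; covers = λ X (X∈b , -δ<y , y<δ) →
          let k , l≤x , x≤u = subinterval K 0<s
                  (proj₁ (X∈b _ _)) (≤-respʳ-≈ u≈l+Ns (proj₂ (X∈b _ _)))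
          in Cover.covers union X (k ,
            ∈-setSide b q {X} (l≤u k) X∈b l≤x x≤u ,
            in-slab X k l≤x x≤u -δ<y y<δ)
      }
      where
      w s : ℝ
      w = width b q
      s = w * ν
      0<s : 0# <ᴿ s
      0<s = *-pos 0<w 0<ν
      l u : Fin (suc K) → ℝ
      l k = entry (lower b) q + toℕ k · s
      u k = l k + (s + s)
      u-l : ∀ k → u k - l k ≈ s + s
      u-l k = solve 2 (λ l s → l :+ (s :+ s) :- l := s :+ s) refl (l k) s
      l<u : ∀ k → l k <ᴿ u k
      l<u k = <-from (+-pos 0<s 0<s) (sym (u-l k))
      l≤u : ∀ k → l k ≤ᴿ u k
      l≤u k = <⇒≤ (l<u k)
      piece : Fin (suc K) → Box m
      piece k = setSide b q (l≤u k)
      u≈l+Ns : entry (upper b) q ≈ entry (lower b) q + suc K · s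
      u≈l+Ns = trans (solve 2 (λ u l → u := l :+ (u :- l)) refl _ _) (+-congˡ (sym (begin
        suc K · s               ≈⟨ ·-*1 (suc K) s ⟩
        suc K · 1# * (w * ν)    ≈⟨ x*yz≈xz*y (suc K · 1#) w ν ⟩
        suc K · 1# * ν * w      ≈⟨ *-congʳ Nν≈1 ⟩
        1# * w                  ≈⟨ *-identityˡ w ⟩
        w                       ∎)))
        where
        open SetoidReasoning setoid
        x*yz≈xz*y : ∀ x y z → x * (y * z) ≈ x * z * y
        x*yz≈xz*y = solve 3 (λ x y z → x :* (y :* z) := x :* z :* y) refl
      -- The term `β * entry X q` is frozen at the left end of the piece and absorbed into the
      -- constant.
      c′ : Fin (suc K) → ℝ
      c′ k = c + β * l k
      slab : ∀ k → Cover (λ X → X ∈ᴮ piece k × - δ′ <ᴿ φ X + c′ k × φ X + c′ k <ᴿ δ′)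
                     (η * ((ν + ν) * volume b))
      slab k = record
        { boxes  = Cover.boxes C
        ; small  = ≤-respʳ-≈ (*-congˡ (volume-setSide b q (l≤u k) width-piece)) (Cover.small C)
        ; covers = Cover.covers C
        }
        where
        C = slabs′ (c′ k) (piece k)
          (set-elim (λ x y _ → x <ᴿ y) (l<u k) b-nondeg)
          (trans (width-setSide-≢ b (l≤u k) (q≢p ∘ ≡.sym)) width≈1)
        width-piece : u k - l k ≈ (ν + ν) * w
        width-piece = trans (u-l k) (solve 2 (λ w ν → w :* ν :+ w :* ν := (ν :+ ν) :* w) refl w ν)
      union = cover-⋃ (suc K) _ slab
      total : suc K · (η * ((ν + ν) * volume b)) ≈ ε * volume b
      total = begin
        suc K · (η * ((ν + ν) * volume b))     ≈⟨ ·-*1 (suc K) _ ⟩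
        suc K · 1# * (η * ((ν + ν) * volume b)) ≈⟨ regroup (suc K · 1#) η ν (volume b) ⟩
        suc K · 1# * ν * ((η + η) * volume b)   ≈⟨ *-cong Nν≈1 (*-congʳ 2η≈ε) ⟩
        1# * (ε * volume b)                     ≈⟨ *-identityˡ _ ⟩
        ε * volume b                            ∎
        where
        open SetoidReasoning setoid
        regroup : ∀ N η ν v → N * (η * ((ν + ν) * v)) ≈ (N * ν) * ((η + η) * v)
        regroup = solve 4 (λ N η ν v →
          N :* (η :* ((ν :+ ν) :* v)) := (N :* ν) :* ((η :+ η) :* v)) refl
      in-slab : ∀ X k → l k ≤ᴿ entry X q → entry X q ≤ᴿ u k →
                - δ <ᴿ φ X + β * entry X q + c → φ X + β * entry X q + c <ᴿ δ →
                - δ′ <ᴿ φ X + c′ k × φ X + c′ k <ᴿ δ′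
      in-slab X k l≤x x≤u -δ<y y<δ =
        <-from (+-pos-nonNeg (x<y⇒0<y-x -δ<y) (x≤y⇒0≤y-x βr≤δ))
          (trans (solve 6 (λ f β x c l δ → (f :+ β :* x :+ c :- :- δ) :+ (δ :- β :* (x :- l))
            := f :+ (c :+ β :* l) :- :- (δ :+ δ)) refl (φ X) β (entry X q) c (l k) δ)
            (+-congˡ (-‿cong (-‿cong 2δ≈δ′)))) ,
        <-from (+-pos-nonNeg (x<y⇒0<y-x y<δ) (x≤y⇒0≤y-x -βr≤δ))
          (trans (solve 6 (λ f β x c l δ → (δ :- (f :+ β :* x :+ c)) :+ (δ :- (:- β) :* (x :- l))
            := (δ :+ δ) :- (f :+ (c :+ β :* l))) refl (φ X) β (entry X q) c (l k) δ)
            (+-congʳ 2δ≈δ′))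
        where
        r = entry X q - l k
        -- Nonnegativity of `r` is weakened to the symmetric bound that `*-bounded` takes.
        0≤r : - (s + s) ≤ᴿ r
        0≤r = ≤-from (+-nonNeg (x≤y⇒0≤y-x l≤x) (<⇒≤ (+-pos 0<s 0<s)))
          (solve 2 (λ r s → r :+ (s :+ s) := r :- :- (s :+ s)) refl r s)
        r≤2s : r ≤ᴿ s + s
        r≤2s = ≤-from (x≤y⇒0≤y-x x≤u)
          (solve 3 (λ x l s → l :+ (s :+ s) :- x := (s :+ s) :- (x :- l)) refl (entry X q) (l k) s)
        M2s≤δ : M * (s + s) ≤ᴿ δ
        M2s≤δ = ≤-respˡ-≈
          (solve 3 (λ M w ν → M :* (w :+ w) :* ν := M :* (w :* ν :+ w :* ν)) refl M w ν) Mwν≤δ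
        βr≤δ : β * r ≤ᴿ δ
        βr≤δ = ≤-trans (*-bounded β≤M -β≤M 0≤r r≤2s) M2s≤δ
        -βr≤δ : - β * r ≤ᴿ δ
        -βr≤δ = ≤-trans (*-bounded -β≤M (≤-respˡ-≈ (sym (-‿involutive β)) β≤M) 0≤r r≤2s) M2s≤δ

  thinSlabs-resp-≈ : ∀ {p : Position m} {φ ψ} → (∀ X → φ X ≈ ψ X) → ThinSlabs p φ → ThinSlabs p ψ
  thinSlabs-resp-≈ φ≈ψ slabs ε 0<ε =
    let δ , 0<δ , slab = slabs ε 0<ε in
    δ , 0<δ , λ c b b-nondeg width≈1 →
      let C = slab c b b-nondeg width≈1 in record
        { boxes  = boxes C
        ; small  = small C
        ; covers = λ X (X∈b , -δ<y , y<δ) → covers C X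
            (X∈b , <-respʳ-≈ (+-congʳ (sym (φ≈ψ X))) -δ<y , <-respˡ-≈ (+-congʳ (sym (φ≈ψ X))) y<δ)
        }

  thinSlabs-sum : ∀ {p : Position m} {φ} n (q : Fin n → Position m) → (∀ j → q j ≢ p) →
                  (β : Fin n → ℝ) → ThinSlabs p φ →
                  ThinSlabs p (λ X → φ X + sum (λ j → β j * entry X (q j)))
  thinSlabs-sum zero    q q≢p β slabs = thinSlabs-resp-≈ (λ X → sym (+-identityʳ _)) slabs
  thinSlabs-sum (suc n) q q≢p β slabs = thinSlabs-resp-≈ (λ X → +-assoc _ _ _)
    (thinSlabs-sum n (q ∘ suc) (q≢p ∘ suc) (β ∘ suc)
      (thinSlabs-+ (q zero) (q≢p zero) (β zero) slabs))

  thinSlabs-sum² : ∀ {p : Position m} {φ} k n (q : Fin k → Fin n → Position m) →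
                   (∀ i j → q i j ≢ p) →
                   (β : Fin k → Fin n → ℝ) → ThinSlabs p φ →
                   ThinSlabs p (λ X → φ X + sum (λ i → sum (λ j → β i j * entry X (q i j))))
  thinSlabs-sum² zero    n q q≢p β slabs = thinSlabs-resp-≈ (λ X → sym (+-identityʳ _)) slabs
  thinSlabs-sum² (suc k) n q q≢p β slabs = thinSlabs-resp-≈ (λ X → +-assoc _ _ _)
    (thinSlabs-sum² k n (q ∘ suc) (q≢p ∘ suc) (β ∘ suc)
      (thinSlabs-sum n (q zero) (q≢p zero) (β zero) slabs))

  infix 7 _∙_
  _∙_ : Matrix n → Matrix n → ℝ
  G ∙ X = sum λ i → sum λ j → G i j * X i j

  -- The term at `p` is the base case; the other entries of its row and then the other rows are
  -- added to it. Enumerating them through `punchIn` guarantees that `p` does not recur.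
  thinSlabs-∙ : ∀ (G : Matrix m) p → entry G p # 0# → ThinSlabs p (G ∙_)
  thinSlabs-∙ {suc m} G p@(i , j) Gp#0 = thinSlabs-resp-≈ regroup
    (thinSlabs-sum² m (suc m) (λ i′ j′ → punchIn i i′ , j′)
      (λ i′ j′ → punchInᵢ≢i i i′ ∘ ≡.cong proj₁)
      (λ i′ → G (punchIn i i′))
      (thinSlabs-sum m (λ j′ → i , punchIn j j′) (λ j′ → punchInᵢ≢i j j′ ∘ ≡.cong proj₂)
        (λ j′ → G i (punchIn j j′))
        (thinSlabs-scaledEntry p Gp#0)))
    where
    regroup : ∀ X → G i j * X i j + sum (λ j′ → G i (punchIn j j′) * X i (punchIn j j′))
                      + sum (λ i′ → sum (λ j′ → G (punchIn i i′) j′ * X (punchIn i i′) j′)) ≈ G ∙ X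
    regroup X = sym (trans (sum-remove {i = i} (λ i′ → sum λ j′ → G i′ j′ * X i′ j′))
      (+-congʳ (sum-remove {i = j} (λ j′ → G i j′ * X i j′))))

  -- It contains the chart image of the polytope, since an entry is at most its row sum, and its
  -- sides of length 1 meet the width condition of `ThinSlabs`.
  unitBox : Box m
  unitBox = record { lower = λ _ _ → 0# ; upper = λ _ _ → 1# ; lower≤upper = λ _ _ → 0≤1 }

  volume-unitBox : volume (unitBox {m}) ≈ 1#
  volume-unitBox {m} = trans (Product.sum-cong-≋ {m} λ i →
    trans (Product.sum-cong-≋ {m} λ j → x-0≈x 1#) (Product.sum-replicate-zero m))
    (Product.sum-replicate-zero m)

  sum-nonNeg : (v : Vector ℝ n) → (∀ i → 0# ≤ᴿ v i) → 0# ≤ᴿ sum v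
  sum-nonNeg {zero}  v 0≤v = ≤-refl
  sum-nonNeg {suc n} v 0≤v = +-nonNeg (0≤v zero) (sum-nonNeg (v ∘ suc) (0≤v ∘ suc))

  chart∈unitBox : (A : DoublyStochastic (suc m)) → chart (matrix A) ∈ᴮ unitBox
  chart∈unitBox A i j = nonNegative A (suc i) (suc j) , ≤-respʳ-≈ sum≈1
    (x≤x+y (sum-nonNeg (removeAt (matrix A (suc i)) (suc j)) λ k → nonNegative A (suc i) _))
    where
    sum≈1 : matrix A (suc i) (suc j) + sum (removeAt (matrix A (suc i)) (suc j)) ≈ 1#
    sum≈1 = trans (sym (sum-remove {i = suc j} (matrix A (suc i))))
      (UnitLineSums.rowSum (unitLineSums A) (suc i))

  -- Whether `x` is apart from zero is undecidable, but comparing `x` with the pairs `- δ`, `0#` and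
  -- `0#`, `δ` decides between two overlapping alternatives. The second one leads into the slab, and
  -- thus into the boxes.
  sign-or-small : ∀ x {δ} → 0# <ᴿ δ → x # 0# ⊎ (- δ <ᴿ x × x <ᴿ δ)
  sign-or-small x {δ} 0<δ
    with <-cotrans (0<-x⇒x<0 (<-respʳ-≈ (sym (-‿involutive δ)) 0<δ)) x | <-cotrans 0<δ x
  ... | inj₂ x<0  | _        = inj₁ (<⇒# x<0)
  ... | inj₁ _    | inj₁ 0<x = inj₁ (0<⇒#0 0<x)
  ... | inj₁ -δ<x | inj₂ x<δ = inj₂ (-δ<x , x<δ)

  ae-affine#0 : ∀ (G : Matrix m) c p → entry G p # 0# →
                FinitelyAE (λ A → G ∙ chart (matrix A) + c # 0#)
  ae-affine#0 {m} G c p Gp#0 ε 0<ε =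
    let δ , 0<δ , slab = thinSlabs-∙ G p Gp#0 ε 0<ε
        C = slab c unitBox (λ _ _ → 0<1) (x-0≈x 1#)
    in boxes C , ≤-respʳ-≈ (trans (*-congˡ (volume-unitBox {m})) (*-identityʳ ε)) (small C) ,
      λ A → Sum.map₂ (λ (-δ<y , y<δ) → covers C _ (chart∈unitBox A , -δ<y , y<δ))
              (sign-or-small (G ∙ chart (matrix A) + c) 0<δ)

-- Linear functionals on matrices, represented by matrices.

module PiecewiseLinear {c ℓ₁ ℓ₂} (R : Reals c ℓ₁ ℓ₂) where

  open OrderedField R
  open Birkhoff R
  open Covers R
  open SemiringSum semiring
    using ( sum-remove; sum-cong-≋; sum-replicate; sum-replicate-zero
          ; ∑-distrib-+; *-distribˡ-sum; ∑-comm)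

  private variable
    m n : ℕ

  ∙-cong : ∀ {G H X Y : Matrix n} → G ≋ H → X ≋ Y → G ∙ X ≈ H ∙ Y
  ∙-cong G≋H X≋Y = sum-cong-≋ λ i → sum-cong-≋ λ j → *-cong (G≋H i j) (X≋Y i j)

  ∙-comm : ∀ (G X : Matrix n) → G ∙ X ≈ X ∙ G
  ∙-comm G X = sum-cong-≋ λ i → sum-cong-≋ λ j → *-comm (G i j) (X i j)

  ∙-isLinear : ∀ (G : Matrix n) → IsLinear (G ∙_)
  ∙-isLinear {n} G = record
    { cong   = ∙-cong λ i j → refl
    ; ⊕-homo = λ X Y → trans
        (sum-cong-≋ λ i →
          trans (sum-cong-≋ λ j → distribˡ (G i j) (X i j) (Y i j)) (∑-distrib-+ {n} _ _))
        (∑-distrib-+ {n} _ _)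
    ; ⊛-homo = λ t X → sym (trans (*-distribˡ-sum {n} t _)
        (sum-cong-≋ λ i → trans (*-distribˡ-sum {n} t _)
          (sum-cong-≋ λ j → x*yz≈y*xz t (G i j) (X i j))))
    }
    where
    x*yz≈y*xz : ∀ x y z → x * (y * z) ≈ y * (x * z)
    x*yz≈y*xz = solve 3 (λ x y z → x :* (y :* z) := y :* (x :* z)) refl

  ∙-distribˡ-⊖ : ∀ (G X Y : Matrix n) → G ∙ (X ⊖ Y) ≈ G ∙ X - G ∙ Y
  ∙-distribˡ-⊖ G X Y = begin
    G ∙ (X ⊖ Y)                ≈⟨ cong (λ i j → +-congˡ (-x≈-1*x (Y i j))) ⟩
    G ∙ (X ⊕ (- 1# ⊛ Y))       ≈⟨ ⊕-homo X (- 1# ⊛ Y) ⟩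
    G ∙ X + G ∙ (- 1# ⊛ Y)     ≈⟨ +-congˡ (⊛-homo (- 1#) Y) ⟩
    G ∙ X + - 1# * (G ∙ Y)     ≈⟨ +-congˡ (-x≈-1*x (G ∙ Y)) ⟨
    G ∙ X - G ∙ Y              ∎
    where
    open SetoidReasoning setoid
    open IsLinear (∙-isLinear G)
    -x≈-1*x : ∀ x → - x ≈ - 1# * x
    -x≈-1*x x = trans (-‿cong (sym (*-identityˡ x))) (-‿distribˡ-* 1# x)

  ∙-distribʳ-⊖ : ∀ (G H X : Matrix n) → (G ⊖ H) ∙ X ≈ G ∙ X - H ∙ X
  ∙-distribʳ-⊖ G H X = trans (∙-comm (G ⊖ H) X) (trans (∙-distribˡ-⊖ X G H)
    (+-cong (∙-comm X G) (-‿cong (∙-comm X H))))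

  ∙-distribʳ-⊕ : ∀ (G H X : Matrix n) → (G ⊕ H) ∙ X ≈ G ∙ X + H ∙ X
  ∙-distribʳ-⊕ G H X = trans (∙-comm (G ⊕ H) X) (trans (IsLinear.⊕-homo (∙-isLinear X) G H)
    (+-cong (∙-comm X G) (∙-comm X H)))

  -- The maximum norm and continuity of linear functionals.

  ≤-foldr-⊔ : ∀ (v : Vector ℝ n) i → v i ≤ᴿ foldr _⊔_ 0# v
  ≤-foldr-⊔ v zero    = x≤x∨y _ _
  ≤-foldr-⊔ v (suc i) = ≤-trans (≤-foldr-⊔ (v ∘ suc) i) (y≤x∨y _ _)

  foldr-⊔-nonNeg : ∀ (v : Vector ℝ n) → 0# ≤ᴿ foldr _⊔_ 0# v
  foldr-⊔-nonNeg {zero}  v = ≤-refl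
  foldr-⊔-nonNeg {suc n} v = ≤-trans (foldr-⊔-nonNeg (v ∘ suc)) (y≤x∨y _ _)

  foldr-⊔-least : ∀ (v : Vector ℝ n) → (∀ i → v i ≤ᴿ 0#) → foldr _⊔_ 0# v ≤ᴿ 0#
  foldr-⊔-least {zero}  v v≤0 = ≤-refl
  foldr-⊔-least {suc n} v v≤0 = ∨-least (v≤0 zero) (foldr-⊔-least (v ∘ suc) (v≤0 ∘ suc))

  ∥_∥-nonNeg : ∀ (X : Matrix n) → 0# ≤ᴿ ∥ X ∥
  ∥ X ∥-nonNeg = foldr-⊔-nonNeg λ i → foldr _⊔_ 0# λ j → ∣ X i j ∣

  ∣entry∣≤∥_∥ : ∀ (X : Matrix n) i j → ∣ X i j ∣ ≤ᴿ ∥ X ∥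
  ∣entry∣≤∥ X ∥ i j = ≤-trans
    (≤-foldr-⊔ (λ j → ∣ X i j ∣) j)
    (≤-foldr-⊔ (λ i → foldr _⊔_ 0# λ j → ∣ X i j ∣) i)

  ∥X⊖X∥≤0 : ∀ (X : Matrix n) → ∥ X ⊖ X ∥ ≤ᴿ 0#
  ∥X⊖X∥≤0 X = foldr-⊔-least _ λ i → foldr-⊔-least _ λ j → ∣0∣≤0 (-‿inverseʳ (X i j))

  -- For a linear functional, this bound applied to differences `B ⊖ A` is continuity at every `A`.
  ContinuousAt0 : (Matrix n → ℝ) → Set (c L.⊔ ℓ₂)
  ContinuousAt0 φ = ∀ η → 0# <ᴿ η → ∃[ δ ] 0# <ᴿ δ × (∀ X → ∥ X ∥ <ᴿ δ → φ X ≤ᴿ η × - φ X ≤ᴿ η)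

  continuous-scaledEntry : ∀ β i j → ContinuousAt0 {n} (λ X → β * X i j)
  continuous-scaledEntry β i j η 0<η =
    let M , 0<M , β≤M , -β≤M = ∣ β ∣-bound
        μ , 0<μ , Mμ≈1 = inverse-pos 0<M
        M[ημ]≈η = trans (*-congˡ (*-comm η μ)) (trans (sym (*-assoc M μ η))
          (trans (*-congʳ Mμ≈1) (*-identityˡ η)))
    in η * μ , *-pos 0<η 0<μ , λ X X<δ →
      let -δ<x , x<δ = ∣x∣<r⇒ (≤-<-trans (∣entry∣≤∥ X ∥ i j) X<δ) in
      ≤-respʳ-≈ M[ημ]≈η (*-bounded β≤M -β≤M (<⇒≤ -δ<x) (<⇒≤ x<δ)) ,
      ≤-respʳ-≈ M[ημ]≈η (≤-respˡ-≈ (sym (-‿distribˡ-* β (X i j)))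
        (*-bounded -β≤M (≤-respˡ-≈ (sym (-‿involutive β)) β≤M) (<⇒≤ -δ<x) (<⇒≤ x<δ)))

  continuous-sum : ∀ k (φ : Fin k → Matrix n → ℝ) → (∀ i → ContinuousAt0 (φ i)) →
                   ContinuousAt0 (λ X → sum (λ i → φ i X))
  continuous-sum zero    φ cont η 0<η =
    η , 0<η , λ X _ → <⇒≤ 0<η , ≤-respˡ-≈ (sym -0#≈0#) (<⇒≤ 0<η)
  continuous-sum (suc k) φ cont η 0<η =
    let h , 0<h , 2h≈η = halve 0<η
        δ₁ , 0<δ₁ , φ₁ = cont zero h 0<h
        δ₂ , 0<δ₂ , φ₂ = continuous-sum k (φ ∘ suc) (cont ∘ suc) h 0<h
        δ , 0<δ , δ≤δ₁ , δ≤δ₂ = positive-lowerBound 0<δ₁ 0<δ₂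
    in δ , 0<δ , λ X X<δ →
      let ≤h₁ , -≤h₁ = φ₁ X (<-≤-trans X<δ δ≤δ₁)
          ≤h₂ , -≤h₂ = φ₂ X (<-≤-trans X<δ δ≤δ₂)
      in ≤-respʳ-≈ 2h≈η (+-mono-≤ ≤h₁ ≤h₂) ,
         ≤-respʳ-≈ 2h≈η (≤-respˡ-≈ (-‿+-comm _ _) (+-mono-≤ -≤h₁ -≤h₂))

  ∙-continuous : ∀ (G : Matrix n) → ContinuousAt0 (G ∙_)
  ∙-continuous {n} G = continuous-sum n _ λ i → continuous-sum n _ λ j →
    continuous-scaledEntry (G i j) i j

  -- With `h` half of `- (D ∙ A)`, a change of at most `h` leaves the value at most `- h`.
  ∙-negative-nearby : ∀ (D A : Matrix n) → D ∙ A <ᴿ 0# →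
                      ∃[ r ] 0# <ᴿ r × (∀ B → ∥ B ⊖ A ∥ <ᴿ r → D ∙ B <ᴿ 0#)
  ∙-negative-nearby D A DA<0 =
    let h , 0<h , 2h≈-DA = halve (x<0⇒0<-x DA<0)
        r , 0<r , near = ∙-continuous D h 0<h
    in r , 0<r , λ B B<r → <-from (+-pos-nonNeg 0<h (x≤y⇒0≤y-x (proj₁ (near (B ⊖ A) B<r))))
      (difference h (D ∙ A) (D ∙ B) (D ∙ (B ⊖ A)) 2h≈-DA (∙-distribˡ-⊖ D B A))
    where
    difference : ∀ h a b d → h + h ≈ - a → d ≈ b - a → h + (h - d) ≈ 0# - b
    difference h a b d 2h≈-a d≈b-a = begin
      h + (h - d)       ≈⟨ +-assoc h h (- d) ⟨
      h + h - d         ≈⟨ +-cong 2h≈-a (-‿cong d≈b-a) ⟩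
      - a - (b - a)     ≈⟨ solve 2 (λ a b → :- a :- (b :- a) := con (+ 0) :- b) refl a b ⟩
      0# - b            ∎
      where open SetoidReasoning setoid

  -- Integer functionals and their form in the chart.

  sum-single : ∀ (v : Vector ℝ n) i → (∀ k → k ≢ i → v k ≈ 0#) → sum v ≈ v i
  sum-single {suc n} v i v≈0 = trans (sum-remove v) (trans (+-congˡ
    (trans (sum-cong-≋ λ k → v≈0 _ (punchInᵢ≢i i k)) (sum-replicate-zero n))) (+-identityʳ (v i)))

  0ᴹ : Matrix n
  0ᴹ _ _ = 0#

  0ᴹ∙X≈0 : ∀ (X : Matrix n) → 0ᴹ ∙ X ≈ 0#
  0ᴹ∙X≈0 {n} X = trans
    (sum-cong-≋ {n} λ i → trans (sum-cong-≋ λ j → zeroˡ (X i j)) (sum-replicate-zero n))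
    (sum-replicate-zero n)

  matrixUnit : Position n → Matrix n
  matrixUnit p = set 0ᴹ p 1#

  matrixUnit-∙ : ∀ p (X : Matrix n) → matrixUnit p ∙ X ≈ entry X p
  matrixUnit-∙ {n} p@(i , j) X = begin
    matrixUnit p ∙ X                           ≈⟨ sum-single _ i other-rows ⟩
    sum (λ j′ → matrixUnit p i j′ * X i j′)
      ≈⟨ sum-single _ j (λ j′ j′≢j → zero-entry (j′≢j ∘ ≡.cong proj₂)) ⟩
    matrixUnit p i j * X i j                   ≈⟨ *-congʳ (reflexive (set-≡ 0ᴹ p 1#)) ⟩
    1# * X i j                                 ≈⟨ *-identityˡ _ ⟩
    X i j                                      ∎
    where
    open SetoidReasoning setoid
    zero-entry : ∀ {q} → q ≢ p → entry (matrixUnit p) q * entry X q ≈ 0#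
    zero-entry q≢p = trans (*-congʳ (reflexive (set-≢ 0ᴹ 1# q≢p))) (zeroˡ _)
    other-rows : ∀ i′ → i′ ≢ i → sum (λ j′ → matrixUnit p i′ j′ * X i′ j′) ≈ 0#
    other-rows i′ i′≢i = trans (sum-cong-≋ λ j′ → zero-entry {i′ , j′} (i′≢i ∘ ≡.cong proj₁))
      (sum-replicate-zero n)

  -- Real entries with a witness of integrality, rather than a matrix over `ℤ`, so that `∙` and its
  -- laws apply directly.
  record IntegerMatrix n : Set (c L.⊔ ℓ₁) where
    field
      coefficients : Matrix n
      isInteger    : ∀ i j → IsInteger (coefficients i j)

  open IntegerMatrix

  infix 7 _∙ᶻ_
  _∙ᶻ_ : IntegerMatrix n → Matrix n → ℝ
  G ∙ᶻ X = coefficients G ∙ X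

  infixl 6 _⊕ᶻ_ _⊖ᶻ_
  _⊕ᶻ_ _⊖ᶻ_ : IntegerMatrix n → IntegerMatrix n → IntegerMatrix n
  G ⊕ᶻ H = record
    { coefficients = coefficients G ⊕ coefficients H
    ; isInteger    = λ i j → isInteger-+ (isInteger G i j) (isInteger H i j)
    }
  G ⊖ᶻ H = record
    { coefficients = coefficients G ⊖ coefficients H
    ; isInteger    = λ i j → isInteger-+ (isInteger G i j) (isInteger-neg (isInteger H i j))
    }

  0ᶻ : IntegerMatrix n
  0ᶻ = record { coefficients = 0ᴹ ; isInteger = λ _ _ → isInteger-0 }

  matrixUnitᶻ : Position n → IntegerMatrix n
  matrixUnitᶻ p = record
    { coefficients = matrixUnit p
    ; isInteger    = set-elim (λ x _ _ → IsInteger x) {Y = 0ᴹ} {y = 0#}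
                       isInteger-1 (λ _ _ → isInteger-0)
    }

  isInteger-sum : ∀ (v : Vector ℝ n) → (∀ i → IsInteger (v i)) → IsInteger (sum v)
  isInteger-sum {zero}  v int = isInteger-0
  isInteger-sum {suc n} v int = isInteger-+ (int zero) (isInteger-sum (v ∘ suc) (int ∘ suc))

  -- Subtracting rowPart i + columnPart j from the (i , j) entry clears the
  -- first row and column of G and, on matrices with unit line sums, changes
  -- the functional by a constant only.
  module _ (G : Matrix (suc m)) where

    rowPart columnPart : Vector ℝ (suc m)
    rowPart i    = G i zero
    columnPart j = G zero j - G zero zero

    reduced : Matrix (suc m)
    reduced i j = G i j - (rowPart i + columnPart j)

    offset : ℝ
    offset = sum rowPart + sum columnPart

    reduced-firstColumn : ∀ i → reduced i zero ≈ 0#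
    reduced-firstColumn i =
      solve 2 (λ a b → a :- (a :+ (b :- b)) := con (+ 0)) refl (G i zero) (G zero zero)

    reduced-firstRow : ∀ j → reduced zero j ≈ 0#
    reduced-firstRow j =
      solve 2 (λ a b → a :- (b :+ (a :- b)) := con (+ 0)) refl (G zero j) (G zero zero)

    reduced-∙ : ∀ X → reduced ∙ X ≈ chart reduced ∙ chart X
    reduced-∙ X = begin
      reduced ∙ X
        ≈⟨ +-congʳ (trans (sum-cong-≋ λ j → 0*x (X zero j) (reduced-firstRow j))
                          (sum-replicate-zero (suc m))) ⟩
      0# + sum (λ i → sum (λ j → reduced (suc i) j * X (suc i) j))
        ≈⟨ +-identityˡ _ ⟩
      sum (λ i → sum (λ j → reduced (suc i) j * X (suc i) j))
        ≈⟨ (sum-cong-≋ λ i → trans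
             (+-congʳ (0*x (X (suc i) zero) (reduced-firstColumn (suc i)))) (+-identityˡ _)) ⟩
      chart reduced ∙ chart X ∎
      where
      open SetoidReasoning setoid
      0*x : ∀ {z} x → z ≈ 0# → z * x ≈ 0#
      0*x x z≈0 = trans (*-congʳ z≈0) (zeroˡ x)

    -- Unit row sums collapse the row part to `sum rowPart`; after the two summations are exchanged,
    -- unit column sums do the same for the column part.
    lineParts-∙ : ∀ A → UnitLineSums A → (λ i j → rowPart i + columnPart j) ∙ A ≈ offset
    lineParts-∙ A unit = begin
      (λ i j → rowPart i + columnPart j) ∙ A
        ≈⟨ ∙-distribʳ-⊕ (λ i j → rowPart i) (λ i j → columnPart j) A ⟩
      (λ i j → rowPart i) ∙ A + (λ i j → columnPart j) ∙ A
        ≈⟨ +-congˡ (∑-comm (λ i j → columnPart j * A i j)) ⟩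
      (λ i j → rowPart i) ∙ A + sum (λ j → sum (λ i → columnPart j * A i j))
        ≈⟨ +-cong (sum-cong-≋ λ i → weighted (rowPart i) (A i) (UnitLineSums.rowSum unit i))
                  (sum-cong-≋ λ j →
                    weighted (columnPart j) (λ i → A i j) (UnitLineSums.colSum unit j)) ⟩
      offset ∎
      where
      open SetoidReasoning setoid
      weighted : ∀ x (v : Vector ℝ (suc m)) → sum v ≈ 1# → sum (λ k → x * v k) ≈ x
      weighted x v sum≈1 = trans (sym (*-distribˡ-sum x v)) (trans (*-congˡ sum≈1) (*-identityʳ x))

    ∙-chart : ∀ A → UnitLineSums A → G ∙ A ≈ chart reduced ∙ chart A + offset
    ∙-chart A unit = begin
      G ∙ A                               ≈⟨ x≈x-y+y _ _ ⟩
      G ∙ A - lineParts ∙ A + lineParts ∙ A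
        ≈⟨ +-cong (sym (∙-distribʳ-⊖ G lineParts A)) (lineParts-∙ A unit) ⟩
      reduced ∙ A + offset                ≈⟨ +-congʳ (reduced-∙ A) ⟩
      chart reduced ∙ chart A + offset    ∎
      where
      open SetoidReasoning setoid
      lineParts : Matrix (suc m)
      lineParts i j = rowPart i + columnPart j
      x≈x-y+y : ∀ x y → x ≈ x - y + y
      x≈x-y+y = solve 2 (λ x y → x := x :- y :+ y) refl

  find-or-all : ∀ {a b} n {P : Fin n → Set a} {Q : Fin n → Set b} →
                (∀ i → P i ⊎ Q i) → (∀ i → P i) ⊎ ∃[ i ] Q i
  find-or-all zero    dec = inj₁ λ ()
  find-or-all (suc n) dec with dec zero | find-or-all n (dec ∘ suc)
  ... | inj₂ q | _            = inj₂ (zero , q)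
  ... | inj₁ _ | inj₂ (i , q) = inj₂ (suc i , q)
  ... | inj₁ p | inj₁ ps      = inj₁ λ { zero → p ; (suc i) → ps i }

  Vanishing : Matrix n → Set (c L.⊔ ℓ₁)
  Vanishing G = ∀ B → UnitLineSums B → G ∙ B ≈ 0#

  -- For a difference of two functionals this settles their minimum near `A`: either they agree on
  -- the whole affine subspace, or they are strictly ordered at `A`, which is an open condition.
  Regular : Matrix n → DoublyStochastic n → Set (c L.⊔ ℓ₁ L.⊔ ℓ₂)
  Regular G A = Vanishing G ⊎ G ∙ matrix A # 0#

  ae-regular : ∀ (G : IntegerMatrix (suc m)) → FinitelyAE (Regular (coefficients G))
  ae-regular {m} Gᶻ = classify
    (find-or-all m λ i → find-or-all m λ j → integer-≈0⊎#0 (N-isInteger i j))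
    (integer-≈0⊎#0 offset-isInteger)
    where
    G : Matrix (suc m)
    G = coefficients Gᶻ
    N : Matrix m
    N = chart (reduced G)
    columnPart-isInteger : ∀ j → IsInteger (columnPart G j)
    columnPart-isInteger j =
      isInteger-+ (isInteger Gᶻ zero j) (isInteger-neg (isInteger Gᶻ zero zero))
    N-isInteger : ∀ i j → IsInteger (N i j)
    N-isInteger i j = isInteger-+ (isInteger Gᶻ (suc i) (suc j))
      (isInteger-neg (isInteger-+ (isInteger Gᶻ (suc i) zero) (columnPart-isInteger (suc j))))
    offset-isInteger : IsInteger (offset G)
    offset-isInteger = isInteger-+ (isInteger-sum (rowPart G) λ i → isInteger Gᶻ i zero)
      (isInteger-sum (columnPart G) columnPart-isInteger)
    constant : (∀ i j → N i j ≈ 0#) → ∀ A → UnitLineSums A → G ∙ A ≈ offset G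
    constant N≈0 A unit = trans (∙-chart G A unit) (trans (+-congʳ
      (trans (∙-cong {Y = chart A} N≈0 λ i j → refl) (0ᴹ∙X≈0 (chart A)))) (+-identityˡ _))
    classify : (∀ i → ∀ j → N i j ≈ 0#) ⊎ (∃[ i ] ∃[ j ] N i j # 0#) →
               offset G ≈ 0# ⊎ offset G # 0# → FinitelyAE (Regular G)
    -- For a constant function the integer `offset` alone selects the alternative, the same one for
    -- every `A`, and the cover is empty.
    classify (inj₁ N≈0) (inj₁ offset≈0) =
      ae-always λ A → inj₁ λ B unit → trans (constant N≈0 B unit) offset≈0
    classify (inj₁ N≈0) (inj₂ offset#0) =
      ae-always λ A → inj₂ (#-congʳ (sym (constant N≈0 (matrix A) (unitLineSums A))) offset#0)
    classify (inj₂ (i , j , Nij#0)) _ =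
      ae-map (λ A #0 → inj₂ (#-congʳ (sym (∙-chart G (matrix A) (unitLineSums A))) #0))
        (ae-affine#0 N (offset G) (i , j) Nij#0)

  -- Functions that generically agree locally with one of finitely many functionals.

  LocallyEquals : (DoublyStochastic n → ℝ) → Matrix n → DoublyStochastic n → Set (c L.⊔ ℓ₁ L.⊔ ℓ₂)
  LocallyEquals f G A = ∃[ r ] 0# <ᴿ r × (∀ B → ∥ matrix B ⊖ matrix A ∥ <ᴿ r → f B ≈ G ∙ matrix B)

  -- The list precedes both `ε` and `A`, so that finitely many exceptional slabs can be covered
  -- before it is known which functional is active at `A`.
  PiecewiseLinear : (DoublyStochastic (suc m) → ℝ) → Set (c L.⊔ ℓ₁ L.⊔ ℓ₂)
  PiecewiseLinear {m} f = ∃[ Gs ] FinitelyAE (λ A →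
    ∃[ G ] G ∈ Gs × LocallyEquals f (coefficients {suc m} G) A)

  piecewiseLinear-∙ : ∀ (f : DoublyStochastic (suc m) → ℝ) G → (∀ A → f A ≈ G ∙ᶻ matrix A) →
                      PiecewiseLinear f
  piecewiseLinear-∙ f G f≈G = [ G ] , ae-always λ A → G , here ≡.refl , 1# , 0<1 , λ B _ → f≈G B

  piecewiseLinear-resp-≈ : ∀ {f g : DoublyStochastic (suc m) → ℝ} → (∀ A → f A ≈ g A) →
                           PiecewiseLinear f → PiecewiseLinear g
  piecewiseLinear-resp-≈ f≈g (Gs , ae) = Gs ,
    ae-map (λ A (G , G∈Gs , r , 0<r , f≈G) →
      G , G∈Gs , r , 0<r , λ B B<r → trans (sym (f≈g B)) (f≈G B B<r)) ae

  piecewiseLinear-map₂ :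
    ∀ (_⋆_ : ℝ → ℝ → ℝ)
    (_⋆ᶻ_ : IntegerMatrix (suc m) → IntegerMatrix (suc m) → IntegerMatrix (suc m)) →
    (∀ {x y u v} → x ≈ y → u ≈ v → x ⋆ u ≈ y ⋆ v) →
    (∀ G H X → (G ⋆ᶻ H) ∙ᶻ X ≈ (G ∙ᶻ X) ⋆ (H ∙ᶻ X)) →
    ∀ {f g} → PiecewiseLinear f → PiecewiseLinear g → PiecewiseLinear (λ A → f A ⋆ g A)
  piecewiseLinear-map₂ _⋆_ _⋆ᶻ_ ⋆-cong homo (Gs , f-ae) (Hs , g-ae) =
    cartesianProductWith _⋆ᶻ_ Gs Hs ,
    ae-map (λ A ((G , G∈Gs , r , 0<r , f≈G) , (H , H∈Hs , s , 0<s , g≈H)) →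
      let t , 0<t , t≤r , t≤s = positive-lowerBound 0<r 0<s in
      G ⋆ᶻ H , ∈-cartesianProductWith⁺ _⋆ᶻ_ G∈Gs H∈Hs , t , 0<t , λ B B<t →
        trans (⋆-cong (f≈G B (<-≤-trans B<t t≤r)) (g≈H B (<-≤-trans B<t t≤s)))
              (sym (homo G H (matrix B))))
      (ae-∩ f-ae g-ae)

  ae-All : ∀ {a p} {I : Set a} {P : I → DoublyStochastic (suc m) → Set p} (xs : List I) →
           (∀ x → FinitelyAE (P x)) → FinitelyAE (λ A → All (λ x → P x A) xs)
  ae-All []       ae = ae-always λ A → []
  ae-All (x ∷ xs) ae = ae-map (λ A (Px , Pxs) → Px ∷ Pxs) (ae-∩ (ae x) (ae-All xs ae))

  locallyEquals-⊓ : ∀ {f g : DoublyStochastic n → ℝ} G H A →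
                    LocallyEquals f G A → LocallyEquals g H A → Regular (G ⊖ H) A →
                    LocallyEquals (λ B → f B ⊓ g B) G A ⊎ LocallyEquals (λ B → f B ⊓ g B) H A
  locallyEquals-⊓ {n} {f} {g} G H A (r , 0<r , f≈G) (s , 0<s , g≈H) = λ
    { (inj₁ vanishing) → inj₁ (always vanishing)
    ; (inj₂ #0)        → apart (#⇒<⊎> #0)
    }
    where
    min≈ : DoublyStochastic n → Set ℓ₁
    min≈ B = f B ⊓ g B ≈ (G ∙ matrix B) ⊓ (H ∙ matrix B)
    both : ∃[ t ] 0# <ᴿ t × (∀ B → ∥ matrix B ⊖ matrix A ∥ <ᴿ t → min≈ B)
    both = let t , 0<t , t≤r , t≤s = positive-lowerBound 0<r 0<s in
      t , 0<t , λ B B<t → ⊓-cong (f≈G B (<-≤-trans B<t t≤r)) (g≈H B (<-≤-trans B<t t≤s))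
    less : ∀ K L X → (K ⊖ L) ∙ X ≤ᴿ 0# → K ∙ X ≤ᴿ L ∙ X
    less K L X ≤0 = ≤-from (x≤y⇒0≤y-x ≤0) (trans (+-identityˡ _) (trans (-‿cong (∙-distribʳ-⊖ K L X))
      (solve 2 (λ k l → :- (k :- l) := l :- k) refl (K ∙ X) (L ∙ X))))
    -- The two functionals coincide on the polytope; choosing `G` is arbitrary.
    always : Vanishing (G ⊖ H) → LocallyEquals (λ B → f B ⊓ g B) G A
    always vanishing = let t , 0<t , min≈ = both in t , 0<t , λ B B<t → trans (min≈ B B<t)
      (x≤y⇒x⊓y≈x (less G H (matrix B) (≤-reflexive (vanishing (matrix B) (unitLineSums B)))))
    apart : (G ⊖ H) ∙ matrix A <ᴿ 0# ⊎ 0# <ᴿ (G ⊖ H) ∙ matrix A →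
            LocallyEquals (λ B → f B ⊓ g B) G A ⊎ LocallyEquals (λ B → f B ⊓ g B) H A
    apart (inj₁ <0) =
      let t , 0<t , min≈ = both
          u , 0<u , near = ∙-negative-nearby (G ⊖ H) (matrix A) <0
          v , 0<v , v≤t , v≤u = positive-lowerBound 0<t 0<u
      in inj₁ (v , 0<v , λ B B<v → trans (min≈ B (<-≤-trans B<v v≤t))
           (x≤y⇒x⊓y≈x (less G H (matrix B) (<⇒≤ (near (matrix B) (<-≤-trans B<v v≤u))))))
    apart (inj₂ 0<) =
      let t , 0<t , min≈ = both
          u , 0<u , near = ∙-negative-nearby (H ⊖ G) (matrix A) swapped
          v , 0<v , v≤t , v≤u = positive-lowerBound 0<t 0<u
      in inj₂ (v , 0<v , λ B B<v → trans (min≈ B (<-≤-trans B<v v≤t))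
           (y≤x⇒x⊓y≈y (less H G (matrix B) (<⇒≤ (near (matrix B) (<-≤-trans B<v v≤u))))))
      where
      swapped : (H ⊖ G) ∙ matrix A <ᴿ 0#
      swapped = 0<-x⇒x<0 (<-respʳ-≈ (trans (∙-distribʳ-⊖ G H (matrix A))
        (trans (solve 2 (λ g h → g :- h := :- (h :- g)) refl (G ∙ matrix A) (H ∙ matrix A))
          (-‿cong (sym (∙-distribʳ-⊖ H G (matrix A)))))) 0<)

  -- The active pair depends on `A` but the boxes may not, so regularity is imposed on the
  -- differences of all pairs of candidates.
  piecewiseLinear-⊓ : ∀ {f g : DoublyStochastic (suc m) → ℝ} →
                      PiecewiseLinear f → PiecewiseLinear g → PiecewiseLinear (λ A → f A ⊓ g A)
  piecewiseLinear-⊓ {m} {f} {g} (Gs , f-ae) (Hs , g-ae) = Gs ++ Hs ,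
    ae-map (λ A ((f-near , g-near) , regular) → combine A f-near g-near regular)
      (ae-∩ (ae-∩ f-ae g-ae) (ae-All (cartesianProductWith _⊖ᶻ_ Gs Hs) ae-regular))
    where
    combine : ∀ A → ∃[ G ] G ∈ Gs × LocallyEquals f (coefficients G) A →
              ∃[ H ] H ∈ Hs × LocallyEquals g (coefficients H) A →
              All (λ D → Regular (coefficients D) A) (cartesianProductWith _⊖ᶻ_ Gs Hs) →
              ∃[ G ] G ∈ Gs ++ Hs × LocallyEquals (λ B → f B ⊓ g B) (coefficients G) A
    combine A (G , G∈Gs , f≈G) (H , H∈Hs , g≈H) regular
      with locallyEquals-⊓ (coefficients G) (coefficients H) A f≈G g≈H
             (All.lookup regular (∈-cartesianProductWith⁺ _⊖ᶻ_ G∈Gs H∈Hs))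
    ... | inj₁ ≈G = G , ∈-++⁺ˡ G∈Gs , ≈G
    ... | inj₂ ≈H = H , ∈-++⁺ʳ Gs H∈Hs , ≈H

  piecewiseLinear-foldr : ∀ (_⋆_ : ℝ → ℝ → ℝ) →
    (∀ {f g : DoublyStochastic (suc m) → ℝ} →
      PiecewiseLinear f → PiecewiseLinear g → PiecewiseLinear (λ A → f A ⋆ g A)) →
    ∀ k {z} (f : Fin k → DoublyStochastic (suc m) → ℝ) →
    PiecewiseLinear z → (∀ i → PiecewiseLinear (f i)) →
    PiecewiseLinear (λ A → foldr _⋆_ (z A) (λ i → f i A))
  piecewiseLinear-foldr _⋆_ ⋆-pl zero    f z-pl f-pl = z-pl
  piecewiseLinear-foldr _⋆_ ⋆-pl (suc k) f z-pl f-pl =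
    ⋆-pl (f-pl zero) (piecewiseLinear-foldr _⋆_ ⋆-pl k (f ∘ suc) z-pl (f-pl ∘ suc))

  piecewiseLinear-0 : PiecewiseLinear {m} (λ A → 0#)
  piecewiseLinear-0 = piecewiseLinear-∙ _ 0ᶻ λ A → sym (0ᴹ∙X≈0 (matrix A))

  piecewiseLinear-+ : ∀ {f g : DoublyStochastic (suc m) → ℝ} →
                      PiecewiseLinear f → PiecewiseLinear g → PiecewiseLinear (λ A → f A + g A)
  piecewiseLinear-+ = piecewiseLinear-map₂ _+_ _⊕ᶻ_ +-cong
    λ G H X → ∙-distribʳ-⊕ (coefficients G) (coefficients H) X

  piecewiseLinear-- : ∀ {f g : DoublyStochastic (suc m) → ℝ} →
                      PiecewiseLinear f → PiecewiseLinear g → PiecewiseLinear (λ A → f A - g A)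
  piecewiseLinear-- = piecewiseLinear-map₂ _-_ _⊖ᶻ_ (λ x≈y u≈v → +-cong x≈y (-‿cong u≈v))
    λ G H X → ∙-distribʳ-⊖ (coefficients G) (coefficients H) X

  -- The factor is an entry of a permutation matrix and does not depend on `A`, so the product stays
  -- linear and its coefficients stay integers.
  piecewiseLinear-*if : ∀ {f : DoublyStochastic (suc m) → ℝ} b →
                        PiecewiseLinear f → PiecewiseLinear (λ A → f A * (if b then 1# else 0#))
  piecewiseLinear-*if true  f-pl = piecewiseLinear-resp-≈ (λ A → sym (*-identityʳ _)) f-pl
  piecewiseLinear-*if false f-pl = piecewiseLinear-resp-≈ (λ A → sym (zeroʳ _)) piecewiseLinear-0

  -- Stated for an arbitrary accessibility proof, so that the induction follows the recursion of
  -- `coefficientAcc` through `rs`.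
  piecewiseLinear-coefficientAcc : ∀ (P : Enumeration (suc m)) ℓ (ac : Acc _<_ ℓ) →
    PiecewiseLinear (λ A → coefficientAcc P (matrix A) ℓ ac)
  piecewiseLinear-coefficientAcc {m} P ℓ (acc rs) =
    -- `minimum` folds the tail starting from the head, so the residue at `zero` is the initial
    -- value.
    piecewiseLinear-foldr _⊓_ piecewiseLinear-⊓ m _ (residue zero) (residue ∘ suc)
    where
    open Enumeration P
    residue : ∀ i → let j = perm ℓ ⟨$⟩ʳ i in PiecewiseLinear (λ A →
      matrix A i j - sum {toℕ ℓ} λ k →
        coefficientAcc P (matrix A) (inject k) (rs (inject-< k))
          * permutationMatrix (perm (inject k)) i j)
    residue i = piecewiseLinear--
      (piecewiseLinear-∙ _ (matrixUnitᶻ (i , perm ℓ ⟨$⟩ʳ i)) λ A → sym (matrixUnit-∙ _ (matrix A)))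
      (piecewiseLinear-foldr _+_ piecewiseLinear-+ (toℕ ℓ) _ piecewiseLinear-0 λ k →
        piecewiseLinear-*if (does (perm (inject k) ⟨$⟩ʳ i ≟ perm ℓ ⟨$⟩ʳ i))
          (piecewiseLinear-coefficientAcc P (inject k) (rs (inject-< k))))

  -- Interior points and differentiability.

  matrixUnit-nonVanishing : ∀ (p : Position (suc m)) → ¬ Vanishing (matrixUnit p)
  matrixUnit-nonVanishing {m} p vanishing =
    -- The witness is the barycentre of the polytope, whose entries all equal the inverse of the
    -- size `suc m`.
    let ν , 0<ν , Nν≈1 = inverse-pos (·1-pos m)
        sum≈1 = trans (sum-replicate (suc m)) (trans (·-*1 (suc m) ν) Nν≈1)
    in <-irrefl (sym (trans (sym (matrixUnit-∙ p (λ _ _ → ν)))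
         (vanishing (λ _ _ → ν) (record { rowSum = λ _ → sum≈1 ; colSum = λ _ → sum≈1 })))) 0<ν

  Positive : DoublyStochastic n → Set ℓ₂
  Positive A = ∀ i j → 0# <ᴿ matrix A i j

  -- Taking an entry is the integer functional of a matrix unit. It does not vanish identically, so
  -- regularity makes the entry apart from zero, and nonnegativity then fixes its sign.
  ae-positive : FinitelyAE {m} Positive
  ae-positive {m} = ae-∀ (suc m) λ i → ae-∀ (suc m) λ j →
    ae-map (λ A → positive A i j) (ae-regular (matrixUnitᶻ (i , j)))
    where
    positive : ∀ A i j → Regular (matrixUnit (i , j)) A → 0# <ᴿ matrix A i j
    positive A i j (inj₁ vanishing) = contradiction vanishing (matrixUnit-nonVanishing (i , j))
    positive A i j (inj₂ #0) with #⇒<⊎> (#-congʳ (matrixUnit-∙ (i , j) (matrix A)) #0)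
    ... | inj₁ <0 = contradiction <0 (nonNegative A i j)
    ... | inj₂ 0< = 0<

  positive-lowerBound-∀ : ∀ n {p} (Q : Fin n → ℝ → Set p) → (∀ i {x y} → x ≤ᴿ y → Q i y → Q i x) →
                          (∀ i → ∃[ x ] 0# <ᴿ x × Q i x) → ∃[ x ] 0# <ᴿ x × (∀ i → Q i x)
  positive-lowerBound-∀ zero    Q down bounds = 1# , 0<1 , λ ()
  positive-lowerBound-∀ (suc n) Q down bounds =
    let x , 0<x , Qx = bounds zero
        y , 0<y , Qy = positive-lowerBound-∀ n (Q ∘ suc) (down ∘ suc) (bounds ∘ suc)
        z , 0<z , z≤x , z≤y = positive-lowerBound 0<x 0<y
    in z , 0<z , λ { zero → down zero z≤x Qx ; (suc i) → down (suc i) z≤y (Qy i) }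

  positive⇒interior : ∀ (A : DoublyStochastic n) → Positive A → ∃[ r ] 0# <ᴿ r ×
    (∀ B → UnitLineSums B → ∥ B ⊖ matrix A ∥ <ᴿ r → NonNegative B)
  positive⇒interior {n} A A>0 =
    let r , 0<r , r≤A = positive-lowerBound-∀ n (λ i x → ∀ j → x ≤ᴿ matrix A i j)
          (λ i x≤y y≤ j → ≤-trans x≤y (y≤ j))
          (λ i → positive-lowerBound-∀ n (λ j x → x ≤ᴿ matrix A i j) (λ j x≤y y≤ → ≤-trans x≤y y≤)
            (λ j → matrix A i j , A>0 i j , ≤-refl))
    in r , 0<r , λ B _ B<r i j → nearby (r≤A i j)
         (proj₁ (∣x∣<r⇒ (≤-<-trans (∣entry∣≤∥ B ⊖ matrix A ∥ i j) B<r)))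
    where
    nearby : ∀ {r a b} → r ≤ᴿ a → - r <ᴿ b - a → 0# ≤ᴿ b
    nearby {r} {a} {b} r≤a -r<b-a = <⇒≤ (<-respʳ-≈
      (solve 3 (λ r a b → (b :- a :- :- r) :+ (a :- r) := b) refl r a b)
      (+-pos-nonNeg (x<y⇒0<y-x -r<b-a) (x≤y⇒0≤y-x r≤a)))

  -- Near `A` the linear approximation is exact, so the radius `r` serves every `ε`.
  locallyEquals⇒differentiableAt : ∀ {f : DoublyStochastic n → ℝ} G A → Positive A →
                                   LocallyEquals f G A → DifferentiableAt f A
  locallyEquals⇒differentiableAt {n} {f} G A A>0 (r , 0<r , f≈G) = record
    { interior     = positive⇒interior A A>0
    ; derivative   = G ∙_
    ; isLinear     = ∙-isLinear G
    ; approximates = λ ε 0<ε → r , 0<r , λ B B<r →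
        ≤-trans (∣0∣≤0 (remainder B B<r)) (*-nonNeg (<⇒≤ 0<ε) ∥ matrix B ⊖ matrix A ∥-nonNeg)
    }
    where
    remainder : ∀ B → ∥ matrix B ⊖ matrix A ∥ <ᴿ r → f B - f A - G ∙ (matrix B ⊖ matrix A) ≈ 0#
    remainder B B<r = begin
      f B - f A - G ∙ (matrix B ⊖ matrix A)
        ≈⟨ +-cong (+-cong (f≈G B B<r) (-‿cong (f≈G A (≤-<-trans (∥X⊖X∥≤0 (matrix A)) 0<r))))
                  (-‿cong (∙-distribˡ-⊖ G (matrix B) (matrix A))) ⟩
      G ∙ matrix B - G ∙ matrix A - (G ∙ matrix B - G ∙ matrix A)
        ≈⟨ -‿inverseʳ _ ⟩
      0# ∎
      where open SetoidReasoning setoid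

  piecewiseLinear⇒ae-differentiable : ∀ {f : DoublyStochastic (suc m) → ℝ} →
                                      PiecewiseLinear f → AlmostEverywhere (DifferentiableAt f)
  piecewiseLinear⇒ae-differentiable (Gs , ae) = finitelyAE⇒ae
    (ae-map (λ A (A>0 , G , _ , f≈G) →
       locallyEquals⇒differentiableAt (coefficients G) A A>0 f≈G)
      (ae-∩ ae-positive ae))

theorem2p5 : ∀ {c ℓ₁ ℓ₂} (R : Reals c ℓ₁ ℓ₂) → let open Birkhoff R in
    (m : ℕ) (P : Enumeration (suc m)) (ℓ : Fin (suc m !)) →
    AlmostEverywhere (DifferentiableAt (coefficient P ℓ))
theorem2p5 R m P ℓ = piecewiseLinear⇒ae-differentiable
  (piecewiseLinear-coefficientAcc P ℓ (<-wellFounded ℓ))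
  where open PiecewiseLinear R
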